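{- Let $\alpha$ be an algebraic integer lying in a quadratic number field. Then there is a natural number $n$ such that $\alpha+n$ is a chromatic root.
   Context: For a finite simple graph $G$, the chromatic polynomial $P_G(q)$ is the unique polynomial whose value at each positive integer $q$ is the number of proper colourings of $G$ with $q$ colours. A chromatic root is a complex number $\alpha$ such that $P_G(\alpha)=0$ for some finite simple graph $G$. A quadratic number field is a field extension of $\mathbb{Q}$ of degree $2$. -}

module Defs where

open import Algebra.Bundles.Raw using (RawRing)
open import Data.Bool using (Bool; true; false)
open import Data.Bool.Properties using () renaming (_≟_ to _≟ᵇ_)
open import Data.Fin using (Fin)
open import Data.Fin.Properties using (all?) renaming (_≟_ to _≟ᶠ_)
open import Data.Integer using (ℤ; +_; 1ℤ) renaming (+-*-rawRing to ℤ-rawRing)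
open import Data.List using (List; []; _∷_; foldr; map; length; filter; last; allFin; cartesianProductWith)
open import Data.Maybe using (just)
open import Data.Nat using (ℕ; zero; suc; _⊔_) renaming (_≤_ to _≤ᴺ_)
import Data.Nat.Properties as ℕₚ
open import Data.Product using (∃-syntax; _×_; _,_)
open import Data.Rational using (ℚ; 0ℚ; 1ℚ; ½; ∣_∣; Positive; NonNegative; 1/_; _≤_) renaming (_+_ to _+ᵠ_; _*_ to _*ᵠ_; -_ to -ᵠ_; _-_ to _-ᵠ_; _/_ to _/ᵠ_)
import Data.Rational.Properties as ℚₚ
open import Data.Rational.Solver using (module +-*-Solver)
open import Data.Vec using (Vec; []; _∷_; lookup)
open import Level using (0ℓ)
open import Relation.Binary.Definitions using (_Respects_)
open import Relation.Binary.PropositionalEquality using (_≡_; _≢_; refl; sym; trans; cong; subst)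
open import Relation.Nullary using (Dec; ¬_; ¬?)
open import Relation.Nullary.Decidable using (_→-dec_)
open import Relation.Unary using (Pred; _∈_)

-- Real numbers: Cauchy sequences of rationals with pointwise operations,
-- considered up to the equivalence _≈ᴿ_ (difference tends to 0).
IsCauchy : (ℕ → ℚ) → Set
IsCauchy s = ∀ ε → .{{Positive ε}} →
  ∃[ N ] (∀ m n → N ≤ᴺ m → N ≤ᴺ n → ∣ s m -ᵠ s n ∣ ≤ ε)

opaque
  const-cauchy : ∀ p → IsCauchy (λ _ → p)
  const-cauchy p ε = 0 , λ _ _ _ _ →
    subst (λ z → ∣ z ∣ ≤ ε) (sym (ℚₚ.+-inverseʳ p))
      (ℚₚ.nonNegative⁻¹ ε {{ℚₚ.pos⇒nonNeg ε}})

  neg-cauchy : ∀ {s} → IsCauchy s → IsCauchy (λ n → -ᵠ s n)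
  neg-cauchy {s} cs ε = let N , h = cs ε in N , λ m n N≤m N≤n →
    subst (_≤ ε)
      (trans (sym (ℚₚ.∣-p∣≡∣p∣ (s m -ᵠ s n)))
             (cong ∣_∣ (ℚₚ.neg-distrib-+ (s m) (-ᵠ s n))))
      (h m n N≤m N≤n)

  +-cauchy : ∀ {s t} → IsCauchy s → IsCauchy t → IsCauchy (λ n → s n +ᵠ t n)
  +-cauchy {s} {t} cs ct ε =
    let instance _ = ℚₚ.pos*pos⇒pos ε ½
        N₁ , h₁ = cs (ε *ᵠ ½)
        N₂ , h₂ = ct (ε *ᵠ ½)
    in N₁ ⊔ N₂ , λ m n p q → let open ℚₚ.≤-Reasoning in begin
      ∣ (s m +ᵠ t m) -ᵠ (s n +ᵠ t n) ∣
        ≡⟨ cong ∣_∣ (solve 4 (λ a b c d → (a :+ b) :- (c :+ d) := (a :- c) :+ (b :- d)) refl (s m) (t m) (s n) (t n)) ⟩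
      ∣ (s m -ᵠ s n) +ᵠ (t m -ᵠ t n) ∣
        ≤⟨ ℚₚ.∣p+q∣≤∣p∣+∣q∣ (s m -ᵠ s n) (t m -ᵠ t n) ⟩
      ∣ s m -ᵠ s n ∣ +ᵠ ∣ t m -ᵠ t n ∣
        ≤⟨ ℚₚ.+-mono-≤ (h₁ m n (ℕₚ.m⊔n≤o⇒m≤o N₁ N₂ p) (ℕₚ.m⊔n≤o⇒m≤o N₁ N₂ q))
                       (h₂ m n (ℕₚ.m⊔n≤o⇒n≤o N₁ N₂ p) (ℕₚ.m⊔n≤o⇒n≤o N₁ N₂ q)) ⟩
      ε *ᵠ ½ +ᵠ ε *ᵠ ½
        ≡⟨ trans (sym (ℚₚ.*-distribˡ-+ ε ½ ½)) (ℚₚ.*-identityʳ ε) ⟩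
      ε ∎
    where open +-*-Solver

  cauchy-bounded : ∀ {s} → IsCauchy s →
    ∃[ B ] Positive B × ∃[ N ] (∀ n → N ≤ᴺ n → ∣ s n ∣ ≤ B)
  cauchy-bounded {s} cs =
    let N , h = cs 1ℚ
        instance _ = ℚₚ.∣-∣-nonNeg (s N)
    in 1ℚ +ᵠ ∣ s N ∣ , ℚₚ.pos+nonNeg⇒pos 1ℚ ∣ s N ∣ , N , λ n N≤n →
      let open ℚₚ.≤-Reasoning in begin
      ∣ s n ∣
        ≡⟨ cong ∣_∣ (solve 2 (λ a b → a := (a :- b) :+ b) refl (s n) (s N)) ⟩
      ∣ (s n -ᵠ s N) +ᵠ s N ∣
        ≤⟨ ℚₚ.∣p+q∣≤∣p∣+∣q∣ (s n -ᵠ s N) (s N) ⟩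
      ∣ s n -ᵠ s N ∣ +ᵠ ∣ s N ∣
        ≤⟨ ℚₚ.+-monoˡ-≤ ∣ s N ∣ (h n N N≤n ℕₚ.≤-refl) ⟩
      1ℚ +ᵠ ∣ s N ∣ ∎
    where open +-*-Solver

  ∣*∣-mono-≤ : ∀ {p q a b} → .{{NonNegative a}} → ∣ p ∣ ≤ a → ∣ q ∣ ≤ b → ∣ p *ᵠ q ∣ ≤ a *ᵠ b
  ∣*∣-mono-≤ {p} {q} {a} {b} p≤a q≤b = let open ℚₚ.≤-Reasoning in begin
    ∣ p *ᵠ q ∣       ≡⟨ ℚₚ.∣p*q∣≡∣p∣*∣q∣ p q ⟩
    ∣ p ∣ *ᵠ ∣ q ∣   ≤⟨ ℚₚ.*-monoʳ-≤-nonNeg ∣ q ∣ {{ℚₚ.∣-∣-nonNeg q}} p≤a ⟩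
    a *ᵠ ∣ q ∣       ≤⟨ ℚₚ.*-monoˡ-≤-nonNeg a q≤b ⟩
    a *ᵠ b           ∎

  *-cauchy : ∀ {s t} → IsCauchy s → IsCauchy t → IsCauchy (λ n → s n *ᵠ t n)
  *-cauchy {s} {t} cs ct ε =
    let A , A>0 , M₁ , a = cauchy-bounded {s} cs
        B , B>0 , M₂ , b = cauchy-bounded {t} ct
        instance
          _ = A>0
          _ = B>0
          _ = ℚₚ.pos⇒nonNeg A
          _ = ℚₚ.pos⇒nonNeg B
          A+B>0 = ℚₚ.pos+pos⇒pos A B
          _ = ℚₚ.pos⇒nonZero (A +ᵠ B)
          _ = ℚₚ.1/pos⇒pos (A +ᵠ B)
        δ = ε *ᵠ 1/ (A +ᵠ B)
        instance _ = ℚₚ.pos*pos⇒pos ε (1/ (A +ᵠ B))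
        N₁ , h₁ = cs δ
        N₂ , h₂ = ct δ
        M = M₁ ⊔ M₂
        N = N₁ ⊔ N₂
    in M ⊔ N , λ m n p q →
      let M≤m = ℕₚ.m⊔n≤o⇒m≤o M N p
          M≤n = ℕₚ.m⊔n≤o⇒m≤o M N q
          N≤m = ℕₚ.m⊔n≤o⇒n≤o M N p
          N≤n = ℕₚ.m⊔n≤o⇒n≤o M N q
          open ℚₚ.≤-Reasoning
      in begin
      ∣ s m *ᵠ t m -ᵠ s n *ᵠ t n ∣
        ≡⟨ cong ∣_∣ (solve 4 (λ w x y z → w :* x :- y :* z := w :* (x :- z) :+ z :* (w :- y)) refl (s m) (t m) (s n) (t n)) ⟩
      ∣ s m *ᵠ (t m -ᵠ t n) +ᵠ t n *ᵠ (s m -ᵠ s n) ∣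
        ≤⟨ ℚₚ.∣p+q∣≤∣p∣+∣q∣ (s m *ᵠ (t m -ᵠ t n)) (t n *ᵠ (s m -ᵠ s n)) ⟩
      ∣ s m *ᵠ (t m -ᵠ t n) ∣ +ᵠ ∣ t n *ᵠ (s m -ᵠ s n) ∣
        ≤⟨ ℚₚ.+-mono-≤
             (∣*∣-mono-≤ {s m} {t m -ᵠ t n} (a m (ℕₚ.m⊔n≤o⇒m≤o M₁ M₂ M≤m))
               (h₂ m n (ℕₚ.m⊔n≤o⇒n≤o N₁ N₂ N≤m) (ℕₚ.m⊔n≤o⇒n≤o N₁ N₂ N≤n)))
             (∣*∣-mono-≤ {t n} {s m -ᵠ s n} (b n (ℕₚ.m⊔n≤o⇒n≤o M₁ M₂ M≤n))
               (h₁ m n (ℕₚ.m⊔n≤o⇒m≤o N₁ N₂ N≤m) (ℕₚ.m⊔n≤o⇒m≤o N₁ N₂ N≤n))) ⟩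
      A *ᵠ δ +ᵠ B *ᵠ δ
        ≡⟨ solve 4 (λ x y e i → x :* (e :* i) :+ y :* (e :* i) := e :* ((x :+ y) :* i)) refl A B ε (1/ (A +ᵠ B)) ⟩
      ε *ᵠ ((A +ᵠ B) *ᵠ 1/ (A +ᵠ B))
        ≡⟨ trans (cong (ε *ᵠ_) (ℚₚ.*-inverseʳ (A +ᵠ B))) (ℚₚ.*-identityʳ ε) ⟩
      ε ∎
    where open +-*-Solver

record ℝ : Set where
  constructor mkℝ
  field
    seq    : ℕ → ℚ
    cauchy : IsCauchy seq

open ℝ public

infix  4 _≈ᴿ_
infixl 6 _+ᴿ_
infixl 7 _*ᴿ_
infix  8 -ᴿ_

_≈ᴿ_ : ℝ → ℝ → Set
x ≈ᴿ y = ∀ ε → .{{Positive ε}} →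
  ∃[ N ] (∀ n → N ≤ᴺ n → ∣ seq x n -ᵠ seq y n ∣ ≤ ε)

fromℚᴿ : ℚ → ℝ
fromℚᴿ p = mkℝ (λ _ → p) (const-cauchy p)

_+ᴿ_ _*ᴿ_ : ℝ → ℝ → ℝ
mkℝ s cs +ᴿ mkℝ t ct = mkℝ (λ n → s n +ᵠ t n) (+-cauchy {s} {t} cs ct)
mkℝ s cs *ᴿ mkℝ t ct = mkℝ (λ n → s n *ᵠ t n) (*-cauchy {s} {t} cs ct)

-ᴿ_ : ℝ → ℝ
-ᴿ mkℝ s cs = mkℝ (λ n → -ᵠ s n) (neg-cauchy {s} cs)

infix  4 _≈_
infixl 6 _+_
infixl 7 _*_
infix  8 -_

record ℂ : Set where
  constructor _+i_
  field
    re im : ℝ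

open ℂ public

_≈_ : ℂ → ℂ → Set
z ≈ w = (re z ≈ᴿ re w) × (im z ≈ᴿ im w)

_+_ _*_ : ℂ → ℂ → ℂ
(a +i b) + (c +i d) = (a +ᴿ c) +i (b +ᴿ d)
(a +i b) * (c +i d) = (a *ᴿ c +ᴿ -ᴿ (b *ᴿ d)) +i (a *ᴿ d +ᴿ b *ᴿ c)

-_ : ℂ → ℂ
- (a +i b) = (-ᴿ a) +i (-ᴿ b)

fromℚ : ℚ → ℂ
fromℚ p = fromℚᴿ p +i fromℚᴿ 0ℚ

fromℤ : ℤ → ℂ
fromℤ k = fromℚ (k /ᵠ 1)

fromℕ : ℕ → ℂ
fromℕ n = fromℤ (+ n)

0ℂ 1ℂ : ℂ
0ℂ = fromℚ 0ℚ
1ℂ = fromℚ 1ℚ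

ℂ-rawRing : RawRing 0ℓ 0ℓ
ℂ-rawRing = record
  { Carrier = ℂ ; _≈_ = _≈_ ; _+_ = _+_ ; _*_ = _*_ ; -_ = -_ ; 0# = 0ℂ ; 1# = 1ℂ }

-- Polynomials, as coefficient lists with the constant term first.
module _ {c ℓ} (R : RawRing c ℓ) where
  private module R = RawRing R

  evalIn : List R.Carrier → R.Carrier → R.Carrier
  evalIn p x = foldr (λ a r → a R.+ x R.* r) R.0# p

ℤ[X] : Set
ℤ[X] = List ℤ

evalℤ : ℤ[X] → ℤ → ℤ
evalℤ = evalIn ℤ-rawRing

evalℂ : ℤ[X] → ℂ → ℂ
evalℂ p = evalIn ℂ-rawRing (map fromℤ p)

Monic : ℤ[X] → Set
Monic p = last p ≡ just 1ℤ

IsAlgebraicInteger : ℂ → Set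
IsAlgebraicInteger α = ∃[ p ] Monic p × evalℂ p α ≈ 0ℂ

record IsSubfield {ℓ} (K : Pred ℂ ℓ) : Set ℓ where
  field
    resp  : K Respects _≈_
    0∈K   : 0ℂ ∈ K
    1∈K   : 1ℂ ∈ K
    +∈K   : ∀ {x y} → x ∈ K → y ∈ K → x + y ∈ K
    -∈K   : ∀ {x} → x ∈ K → - x ∈ K
    *∈K   : ∀ {x y} → x ∈ K → y ∈ K → x * y ∈ K
    inv∈K : ∀ {x} → x ∈ K → ¬ x ≈ 0ℂ → ∃[ y ] y ∈ K × x * y ≈ 1ℂ

-- Degree 2 over ℚ: there is a ℚ-basis b₁, b₂.
record IsQuadraticField {ℓ} (K : Pred ℂ ℓ) : Set ℓ where
  field
    isSubfield  : IsSubfield K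
    b₁ b₂       : ℂ
    b₁∈K        : b₁ ∈ K
    b₂∈K        : b₂ ∈ K
    spanning    : ∀ {x} → x ∈ K → ∃[ p ] ∃[ q ] x ≈ fromℚ p * b₁ + fromℚ q * b₂
    independent : ∀ p q → fromℚ p * b₁ + fromℚ q * b₂ ≈ 0ℂ → p ≡ 0ℚ × q ≡ 0ℚ

record Graph : Set where
  field
    order  : ℕ
    adj    : Fin order → Fin order → Bool
    symm   : ∀ u v → adj u v ≡ adj v u
    irrefl : ∀ u → adj u u ≡ false

module _ (G : Graph) where
  open Graph G

  Proper : ∀ {q} → Vec (Fin q) order → Set
  Proper c = ∀ u v → adj u v ≡ true → lookup c u ≢ lookup c v

  proper? : ∀ {q} (c : Vec (Fin q) order) → Dec (Proper c)
  proper? c = all? λ u → all? λ v → (adj u v ≟ᵇ true) →-dec ¬? (lookup c u ≟ᶠ lookup c v)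

-- Every vector occurs exactly once.
allVecs : ∀ q n → List (Vec (Fin q) n)
allVecs q zero    = [] ∷ []
allVecs q (suc n) = cartesianProductWith _∷_ (allFin q) (allVecs q n)

numProperColourings : Graph → ℕ → ℕ
numProperColourings G q = length (filter (proper? G) (allVecs q (Graph.order G)))

-- Determines P up to trailing zero coefficients; taking P over ℤ loses nothing,
-- since the chromatic polynomial of every graph has integer coefficients.
IsChromaticPolynomial : Graph → ℤ[X] → Set
IsChromaticPolynomial G P = ∀ q → 1 ≤ᴺ q → evalℤ P (+ q) ≡ + numProperColourings G q

IsChromaticRoot : ℂ → Set
IsChromaticRoot α = ∃[ G ] ∃[ P ] IsChromaticPolynomial G P × evalℂ P α ≈ 0ℂ

{-# OPTIONS --safe #-}

-- Comparing coordinates of 1, α and α² in a basis of the field gives d α² = b α + c with integers b, c and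
-- d ≥ 1; by Gauss's lemma d divides b and c, so α² = u α + v for integers u, v.
--
-- Take a clique on w + s + t vertices and two further adjacent vertices, one missing exactly s vertices of the
-- clique and the other missing exactly t others. Colouring the clique first, and then the two vertices, shows
-- that the chromatic polynomial is (q)ₐ ((x + s)(x + t) − x) with a = w + s + t and x = q − a. At q = α + t the
-- quadratic factor is (α − w)(α + t − w − s) − (α − w − s), which equals α² − u α − v as soon as
-- s = w² − u w − v and t = s + 2 w + 1 − u. Both are natural numbers when w is large.
module Submission where

open import Algebra.Bundles using (CommutativeRing)
open import Algebra.Solver.Ring.AlmostCommutativeRing using (_-Raw-AlmostCommutative⟶_; fromCommutativeRing)
import Data.Rational
open import Level using (0ℓ)

-- Equality in `ℂ` is convergence of sequences and cannot be decided. Every case distinction is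
-- therefore made on rational numbers, and the independence of the basis is the only bridge from an
-- equation in `ℂ` back to one in `ℚ`. In particular α itself may be rational, and then the
-- coordinates of 1 and α determine no relation for α². This is detected by the determinant of these
-- coordinates; X p is then divided by X (d X - b), so that one argument about quadratic divisors
-- covers both cases. Gauss's lemma is proved without polynomials over `ℚ`: p is pseudo-divided by d
-- X² - b X - c, the remainder is shown to vanish, and a prime of d that does not divide both b and
-- c could be cancelled from the resulting integer identity for ever. The parameters are forced up
-- to the choice of w. The coefficient of α in the quadratic factor fixes t - s, and the constant
-- term then makes s the value of X² - u X - v at w, which is positive for large w.

module Counting where
  open import Data.Bool using (Bool; true; false; if_then_else_)
  open import Data.Fin using (Fin; zero; suc)
  open import Data.Fin.Properties using (_≟_)
  open import Data.Fin.Subset using (Subset; ⊤; _∪_; ∣_∣)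
  open import Data.Fin.Subset.Properties using (∣⊤∣≡n)
  open import Data.Integer using (ℤ; +_; 0ℤ; 1ℤ; _+_; _*_; _-_; -_)
  import Data.Integer.Properties as ℤₚ
  open import Data.Integer.Tactic.RingSolver using (solve-∀)
  open import Data.List using (List; []; _∷_; _++_; map; length; filter; tabulate; allFin; cartesianProductWith)
  open import Data.Nat as ℕ using (ℕ; zero; suc)
  open import Data.Product using (∃-syntax; _×_; _,_; proj₁; proj₂)
  open import Data.Vec using (Vec; []; _∷_; lookup)
  open import Data.Vec.Properties using (lookup-replicate)
  open import Function using (_∘_)
  open import Relation.Binary.PropositionalEquality using (_≡_; _≢_; refl; sym; trans; cong; cong₂; module ≡-Reasoning)
  open import Relation.Nullary using (Dec; does; yes; no; ¬_; contradiction)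
  open import Relation.Unary using (Pred; Decidable)
  open import Defs using (Graph; Proper; proper?; allVecs; numProperColourings)
  open ≡-Reasoning

  -- Finite sums of integers and indicator functions.

  ∑ : ∀ {a} {A : Set a} → List A → (A → ℤ) → ℤ
  ∑ []       f = 0ℤ
  ∑ (x ∷ xs) f = f x + ∑ xs f

  module _ {a} {A : Set a} where

    ∑-cong : ∀ xs {f g : A → ℤ} → (∀ x → f x ≡ g x) → ∑ xs f ≡ ∑ xs g
    ∑-cong []       f≡g = refl
    ∑-cong (x ∷ xs) f≡g = cong₂ _+_ (f≡g x) (∑-cong xs f≡g)

    ∑-++ : ∀ xs ys (f : A → ℤ) → ∑ (xs ++ ys) f ≡ ∑ xs f + ∑ ys f
    ∑-++ []       ys f = sym (ℤₚ.+-identityˡ _)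
    ∑-++ (x ∷ xs) ys f = trans (cong (_+_ (f x)) (∑-++ xs ys f)) (sym (ℤₚ.+-assoc (f x) _ _))

    ∑-zero : ∀ (xs : List A) → ∑ xs (λ _ → 0ℤ) ≡ 0ℤ
    ∑-zero []       = refl
    ∑-zero (x ∷ xs) = trans (ℤₚ.+-identityˡ _) (∑-zero xs)

    ∑-+ : ∀ xs (f g : A → ℤ) → ∑ xs (λ x → f x + g x) ≡ ∑ xs f + ∑ xs g
    ∑-+ []       f g = refl
    ∑-+ (x ∷ xs) f g = trans (cong (_+_ (f x + g x)) (∑-+ xs f g)) (shuffle (f x) (g x) _ _)
      where
      shuffle : ∀ a b c d → a + b + (c + d) ≡ a + c + (b + d)
      shuffle = solve-∀

    ∑-*ˡ : ∀ xs k (f : A → ℤ) → ∑ xs (λ x → k * f x) ≡ k * ∑ xs f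
    ∑-*ˡ []       k f = sym (ℤₚ.*-zeroʳ k)
    ∑-*ˡ (x ∷ xs) k f = trans (cong (_+_ (k * f x)) (∑-*ˡ xs k f)) (sym (ℤₚ.*-distribˡ-+ k (f x) _))

    ∑-*ʳ : ∀ xs k (f : A → ℤ) → ∑ xs (λ x → f x * k) ≡ ∑ xs f * k
    ∑-*ʳ xs k f = trans (∑-cong xs λ x → ℤₚ.*-comm (f x) k) (trans (∑-*ˡ xs k f) (ℤₚ.*-comm k _))

    ∑-- : ∀ xs (f g : A → ℤ) → ∑ xs (λ x → f x - g x) ≡ ∑ xs f - ∑ xs g
    ∑-- xs f g = begin
      ∑ xs (λ x → f x - g x)              ≡⟨ ∑-+ xs f (λ x → - g x) ⟩
      ∑ xs f + ∑ xs (λ x → - g x)         ≡⟨ cong (_+_ (∑ xs f)) (∑-cong xs λ x → sym (ℤₚ.-1*i≡-i (g x))) ⟩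
      ∑ xs f + ∑ xs (λ x → - 1ℤ * g x)    ≡⟨ cong (_+_ (∑ xs f)) (trans (∑-*ˡ xs (- 1ℤ) g) (ℤₚ.-1*i≡-i _)) ⟩
      ∑ xs f - ∑ xs g                     ∎

    module _ {b} {B : Set b} where

      ∑-map : ∀ (h : A → B) xs f → ∑ (map h xs) f ≡ ∑ xs (f ∘ h)
      ∑-map h []       f = refl
      ∑-map h (x ∷ xs) f = cong (_+_ (f (h x))) (∑-map h xs f)

  ∑-swap : ∀ {a b} {A : Set a} {B : Set b} xs (ys : List B) (f : A → B → ℤ) →
    ∑ xs (λ x → ∑ ys (f x)) ≡ ∑ ys (λ y → ∑ xs (λ x → f x y))
  ∑-swap []       ys f = sym (∑-zero ys)
  ∑-swap (x ∷ xs) ys f = trans (cong (_+_ (∑ ys (f x))) (∑-swap xs ys f)) (sym (∑-+ ys (f x) _))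

  ∑-cartesianProductWith : ∀ {a b c} {A : Set a} {B : Set b} {C : Set c} (h : A → B → C) xs ys f →
    ∑ (cartesianProductWith h xs ys) f ≡ ∑ xs (λ x → ∑ ys (λ y → f (h x y)))
  ∑-cartesianProductWith h []       ys f = refl
  ∑-cartesianProductWith h (x ∷ xs) ys f = trans (∑-++ (map (h x) ys) _ f)
    (cong₂ _+_ (∑-map (h x) ys f) (∑-cartesianProductWith h xs ys f))

  ∑-tabulate : ∀ {a} {A : Set a} {n} (h : Fin n → A) f → ∑ (tabulate h) f ≡ ∑ (allFin n) (f ∘ h)
  ∑-tabulate {n = zero}  h f = refl
  ∑-tabulate {n = suc n} h f = cong (_+_ (f (h zero)))
    (trans (∑-tabulate (h ∘ suc) f) (sym (∑-tabulate suc (f ∘ h))))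

  indicator : ∀ {p} {P : Set p} → Dec P → ℤ
  indicator P? = if does P? then 1ℤ else 0ℤ

  +length-filter : ∀ {a p} {A : Set a} {P : Pred A p} (P? : Decidable P) xs →
    + length (filter P? xs) ≡ ∑ xs (λ x → indicator (P? x))
  +length-filter P? []       = refl
  +length-filter P? (x ∷ xs) with does (P? x)
  ... | true  = cong (_+_ 1ℤ) (+length-filter P? xs)
  ... | false = trans (+length-filter P? xs) (sym (ℤₚ.+-identityˡ _))

  δ : ∀ {n} → Fin n → Fin n → ℤ
  δ x y = indicator (x ≟ y)

  ∑-δ : ∀ {n} (y : Fin n) (f : Fin n → ℤ) → ∑ (allFin n) (λ x → δ x y * f x) ≡ f y
  ∑-δ {suc n} zero    f = begin
    1ℤ * f zero + ∑ (tabulate suc) (λ x → δ x zero * f x) ≡⟨ cong₂ _+_ (ℤₚ.*-identityˡ (f zero)) (∑-tabulate {A = Fin (suc n)} suc _) ⟩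
    f zero + ∑ (allFin n) (λ _ → 0ℤ)                      ≡⟨ cong (_+_ (f zero)) (∑-zero (allFin n)) ⟩
    f zero + 0ℤ                                           ≡⟨ ℤₚ.+-identityʳ (f zero) ⟩
    f zero                                                ∎
  ∑-δ {suc n} (suc y) f = trans (ℤₚ.+-identityˡ _) (trans (∑-tabulate {A = Fin (suc n)} suc _) (∑-δ y (f ∘ suc)))

  ∑-one : ∀ n → ∑ (allFin n) (λ _ → 1ℤ) ≡ + n
  ∑-one zero    = refl
  ∑-one (suc n) = cong (_+_ 1ℤ) (trans (∑-tabulate {A = Fin (suc n)} suc _) (∑-one n))

  -- Separates the value of an indicator from the decision procedure producing it, so that the
  -- indicator of a decision can be compared with a product such as `avoids`.
  data Indicates {p} (P : Set p) : ℤ → Set p where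
    holds :   P → Indicates P 1ℤ
    fails : ¬ P → Indicates P 0ℤ

  indicator-indicates : ∀ {p} {P : Set p} (P? : Dec P) → Indicates P (indicator P?)
  indicator-indicates (yes p) = holds p
  indicator-indicates (no ¬p) = fails ¬p

  indicates-unique : ∀ {p q} {P : Set p} {Q : Set q} {y z} →
    (P → Q) → (Q → P) → Indicates P y → Indicates Q z → y ≡ z
  indicates-unique f g (holds p) (holds q) = refl
  indicates-unique f g (holds p) (fails ¬q) = contradiction (f p) ¬q
  indicates-unique f g (fails ¬p) (holds q) = contradiction (g q) ¬p
  indicates-unique f g (fails ¬p) (fails ¬q) = refl

  indicates-× : ∀ {p q} {P : Set p} {Q : Set q} {y z} →
    Indicates P y → Indicates Q z → Indicates (P × Q) (y * z)
  indicates-× (holds p)  (holds q)  = holds (p , q)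
  indicates-× (holds _)  (fails ¬q) = fails (¬q ∘ proj₂)
  indicates-× (fails ¬p) (holds _)  = fails (¬p ∘ proj₁)
  indicates-× (fails ¬p) (fails _)  = fails (¬p ∘ proj₁)

  -- The weight k is 0 whenever `P` fails, so y and z need to agree only under `P`. This lets a sum
  -- over all vectors be treated as a sum over proper colourings.
  indicates-*-cong : ∀ {p} {P : Set p} {k y z} → Indicates P k → (P → y ≡ z) → k * y ≡ k * z
  indicates-*-cong (holds p) h = cong (_*_ 1ℤ) (h p)
  indicates-*-cong (fails _) h = refl

  -- Adding a vertex with prescribed neighbours.

  Avoids : ∀ {q n} → Subset n → Vec (Fin q) n → Fin q → Set
  Avoids N c x = ∀ i → lookup N i ≡ true → x ≢ lookup c i

  -- A product of factors 1 - δ rather than a decision: peeling off one factor makes the sum over x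
  -- computable by linearity.
  avoids : ∀ {q n} → Subset n → Vec (Fin q) n → Fin q → ℤ
  avoids []          []      x = 1ℤ
  avoids (true  ∷ N) (y ∷ c) x = (1ℤ - δ x y) * avoids N c x
  avoids (false ∷ N) (y ∷ c) x = avoids N c x

  avoids-indicates : ∀ {q n} (N : Subset n) (c : Vec (Fin q) n) x → Indicates (Avoids N c x) (avoids N c x)
  avoids-indicates []          []      x = holds λ ()
  avoids-indicates (false ∷ N) (y ∷ c) x with avoids N c x | avoids-indicates N c x
  ... | _ | holds p  = holds λ { zero () ; (suc i) → p i }
  ... | _ | fails ¬p = fails λ p → ¬p (p ∘ suc)
  avoids-indicates (true ∷ N)  (y ∷ c) x with x ≟ y | avoids N c x | avoids-indicates N c x
  ... | yes x≡y | _ | _        = fails λ p → p zero refl x≡y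
  ... | no  _   | _ | fails ¬p = fails λ p → ¬p (p ∘ suc)
  ... | no  x≢y | _ | holds p  = holds λ { zero _ → x≢y ; (suc i) → p i }

  avoids-∪ : ∀ {q n} (M N : Subset n) (c : Vec (Fin q) n) x → avoids M c x * avoids N c x ≡ avoids (M ∪ N) c x
  avoids-∪ []          []          []      x = refl
  avoids-∪ (false ∷ M) (false ∷ N) (y ∷ c) x = avoids-∪ M N c x
  avoids-∪ (false ∷ M) (true ∷ N)  (y ∷ c) x =
    trans (move (avoids M c x) (1ℤ - δ x y) (avoids N c x)) (cong (_*_ (1ℤ - δ x y)) (avoids-∪ M N c x))
    where
    move : ∀ a b c → a * (b * c) ≡ b * (a * c)
    move = solve-∀
  avoids-∪ (true ∷ M)  (false ∷ N) (y ∷ c) x =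
    trans (ℤₚ.*-assoc (1ℤ - δ x y) _ _) (cong (_*_ (1ℤ - δ x y)) (avoids-∪ M N c x))
  -- A vertex in both sets contributes the factor 1 - δ twice on the left and once on the right; the
  -- factor is 0 or 1, hence idempotent.
  avoids-∪ (true ∷ M)  (true ∷ N)  (y ∷ c) x with x ≟ y
  ... | yes _ = refl
  ... | no  _ = trans (simplify (avoids M c x) (avoids N c x)) (cong (_*_ 1ℤ) (avoids-∪ M N c x))
    where
    simplify : ∀ a b → (1ℤ * a) * (1ℤ * b) ≡ 1ℤ * (a * b)
    simplify = solve-∀

  cone : (G : Graph) → Subset (Graph.order G) → Graph
  cone G N = record { order = suc (Graph.order G) ; adj = adj′ ; symm = symm′ ; irrefl = irrefl′ }
    where
    open Graph G
    adj′ : Fin (suc order) → Fin (suc order) → Bool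
    adj′ zero    zero    = false
    adj′ zero    (suc v) = lookup N v
    adj′ (suc u) zero    = lookup N u
    adj′ (suc u) (suc v) = adj u v
    symm′ : ∀ u v → adj′ u v ≡ adj′ v u
    symm′ zero    zero    = refl
    symm′ zero    (suc v) = refl
    symm′ (suc u) zero    = refl
    symm′ (suc u) (suc v) = symm u v
    irrefl′ : ∀ u → adj′ u u ≡ false
    irrefl′ zero    = refl
    irrefl′ (suc u) = irrefl u

  module _ (G : Graph) (N : Subset (Graph.order G)) {q : ℕ} where

    cone-proper⁻ : ∀ {x} {c : Vec (Fin q) _} → Proper (cone G N) (x ∷ c) → Avoids N c x × Proper G c
    cone-proper⁻ p = (λ i → p zero (suc i)) , (λ u v → p (suc u) (suc v))

    cone-proper⁺ : ∀ {x} {c : Vec (Fin q) _} → Avoids N c x × Proper G c → Proper (cone G N) (x ∷ c)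
    cone-proper⁺ (a , p) zero    zero    ()
    cone-proper⁺ (a , p) zero    (suc v) e = a v e
    cone-proper⁺ (a , p) (suc u) zero    e = a u e ∘ sym
    cone-proper⁺ (a , p) (suc u) (suc v) e = p u v e

    indicator-cone : ∀ x (c : Vec (Fin q) _) →
      indicator (proper? (cone G N) (x ∷ c)) ≡ avoids N c x * indicator (proper? G c)
    indicator-cone x c = indicates-unique cone-proper⁻ cone-proper⁺
      (indicator-indicates (proper? (cone G N) (x ∷ c)))
      (indicates-× (avoids-indicates N c x) (indicator-indicates (proper? G c)))

  -- Sums `F` over proper colourings, by weights on all vectors instead of a filtered list, so that
  -- sums can be exchanged.
  ∑ᶜ : ∀ G q → (Vec (Fin q) (Graph.order G) → ℤ) → ℤ
  ∑ᶜ G q F = ∑ (allVecs q (Graph.order G)) λ c → indicator (proper? G c) * F c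

  ∑ᶜ-cong : ∀ G q {F F′} → (∀ c → Proper G c → F c ≡ F′ c) → ∑ᶜ G q F ≡ ∑ᶜ G q F′
  ∑ᶜ-cong G q h = ∑-cong (allVecs q (Graph.order G)) λ c → indicates-*-cong (indicator-indicates (proper? G c)) (h c)

  ∑ᶜ-*ʳ : ∀ G q k → ∑ᶜ G q (λ _ → k) ≡ ∑ᶜ G q (λ _ → 1ℤ) * k
  ∑ᶜ-*ʳ G q k = trans (∑-cong (allVecs q (Graph.order G)) λ c → cong (_* k) (sym (ℤₚ.*-identityʳ (indicator (proper? G c))))) (∑-*ʳ (allVecs q (Graph.order G)) k _)

  numProperColourings-∑ᶜ : ∀ G q → + numProperColourings G q ≡ ∑ᶜ G q (λ _ → 1ℤ)
  numProperColourings-∑ᶜ G q = trans (+length-filter (proper? G) (allVecs q (Graph.order G)))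
    (∑-cong (allVecs q (Graph.order G)) λ c → sym (ℤₚ.*-identityʳ _))

  -- The new vertex has index `zero`, so its colour is the head of the vector. Moving the sum over
  -- this colour inside leaves, for each colouring of `G`, a count of its extensions.
  ∑ᶜ-cone : ∀ G N q F → ∑ᶜ (cone G N) q F ≡ ∑ᶜ G q (λ c → ∑ (allFin q) (λ x → avoids N c x * F (x ∷ c)))
  ∑ᶜ-cone G N q F = begin
    ∑ (cartesianProductWith _∷_ (allFin q) cs) (λ d → indicator (proper? (cone G N) d) * F d)
      ≡⟨ ∑-cartesianProductWith _∷_ (allFin q) cs (λ d → indicator (proper? (cone G N) d) * F d) ⟩
    ∑ (allFin q) (λ x → ∑ cs (λ c → indicator (proper? (cone G N) (x ∷ c)) * F (x ∷ c)))
      ≡⟨ ∑-swap (allFin q) cs (λ x c → indicator (proper? (cone G N) (x ∷ c)) * F (x ∷ c)) ⟩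
    ∑ cs (λ c → ∑ (allFin q) (λ x → indicator (proper? (cone G N) (x ∷ c)) * F (x ∷ c)))
      ≡⟨ ∑-cong cs (λ c → trans (∑-cong (allFin q) (λ x →
           trans (cong (_* F (x ∷ c)) (indicator-cone G N x c)) (move (avoids N c x) (indicator (proper? G c)) (F (x ∷ c)))))
           (∑-*ˡ (allFin q) (indicator (proper? G c)) _)) ⟩
    ∑ᶜ G q (λ c → ∑ (allFin q) (λ x → avoids N c x * F (x ∷ c))) ∎
    where
    cs = allVecs q (Graph.order G)
    move : ∀ a b c → (a * b) * c ≡ b * (a * c)
    move = solve-∀

  -- Cliques, and cliques with two further adjacent vertices.

  empty : Graph
  empty = record { order = 0 ; adj = λ () ; symm = λ () ; irrefl = λ () }

  complete : ℕ → Graph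
  complete zero    = empty
  complete (suc a) = cone (complete a) ⊤

  order-complete : ∀ a → Graph.order (complete a) ≡ a
  order-complete zero    = refl
  order-complete (suc a) = cong suc (order-complete a)

  module _ {q : ℕ} where

    -- Forbidding y costs one colour if y was still allowed, and none otherwise.
    ∑-avoids-remove : ∀ {n} y (N : Subset n) (c : Vec (Fin q) n) →
      ∑ (allFin q) (λ x → (1ℤ - δ x y) * avoids N c x) ≡ ∑ (allFin q) (avoids N c) - avoids N c y
    ∑-avoids-remove y N c = begin
      ∑ (allFin q) (λ x → (1ℤ - δ x y) * avoids N c x)
        ≡⟨ ∑-cong (allFin q) (λ x → expand (δ x y) (avoids N c x)) ⟩
      ∑ (allFin q) (λ x → avoids N c x - δ x y * avoids N c x)
        ≡⟨ ∑-- (allFin q) (avoids N c) _ ⟩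
      ∑ (allFin q) (avoids N c) - ∑ (allFin q) (λ x → δ x y * avoids N c x)
        ≡⟨ cong (λ z → ∑ (allFin q) (avoids N c) - z) (∑-δ y (avoids N c)) ⟩
      ∑ (allFin q) (avoids N c) - avoids N c y ∎
      where
      expand : ∀ d a → (1ℤ - d) * a ≡ a - d * a
      expand = solve-∀

    avoids≡1 : ∀ {n} (N : Subset n) (c : Vec (Fin q) n) {x} → Avoids ⊤ c x → avoids N c x ≡ 1ℤ
    avoids≡1 N c {x} p = indicates-unique (λ a → a) (λ a → a) (avoids-indicates N c x)
      (holds λ i _ → p i (lookup-replicate i true))

    -- A proper colouring gives the clique vertices distinct colours, so each vertex of `N` forbids
    -- a new one. No bound on q is required: if q is smaller than the clique, there is no proper c.
    ∑-avoids : ∀ a N (c : Vec (Fin q) _) → Proper (complete a) c → ∑ (allFin q) (avoids N c) ≡ + q - + ∣ N ∣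
    ∑-avoids zero    []          []      _ = trans (∑-one q) (sym (ℤₚ.+-identityʳ (+ q)))
    ∑-avoids (suc a) (false ∷ N) (y ∷ c) p = ∑-avoids a N c (proj₂ (cone-proper⁻ (complete a) ⊤ p))
    ∑-avoids (suc a) (true ∷ N)  (y ∷ c) p = begin
      ∑ (allFin q) (λ x → (1ℤ - δ x y) * avoids N c x) ≡⟨ ∑-avoids-remove y N c ⟩
      ∑ (allFin q) (avoids N c) - avoids N c y         ≡⟨ cong₂ _-_ (∑-avoids a N c p′) (avoids≡1 N c y∉c) ⟩
      + q - + ∣ N ∣ - 1ℤ                               ≡⟨ regroup (+ q) (+ ∣ N ∣) ⟩
      + q - (1ℤ + + ∣ N ∣)                             ∎
      where
      y∉c = proj₁ (cone-proper⁻ (complete a) ⊤ p)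
      p′  = proj₂ (cone-proper⁻ (complete a) ⊤ p)
      regroup : ∀ q n → q - n - 1ℤ ≡ q - (1ℤ + n)
      regroup = solve-∀

  fallingFactorial : ℤ → ℕ → ℤ
  fallingFactorial x zero    = 1ℤ
  fallingFactorial x (suc a) = fallingFactorial x a * (x - + a)

  ∑ᶜ-complete : ∀ a q → ∑ᶜ (complete a) q (λ _ → 1ℤ) ≡ fallingFactorial (+ q) a
  ∑ᶜ-complete zero    q = refl
  ∑ᶜ-complete (suc a) q = begin
    ∑ᶜ (complete (suc a)) q (λ _ → 1ℤ)
      ≡⟨ ∑ᶜ-cone (complete a) ⊤ q (λ _ → 1ℤ) ⟩
    ∑ᶜ (complete a) q (λ c → ∑ (allFin q) (λ x → avoids ⊤ c x * 1ℤ))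
      ≡⟨ ∑ᶜ-cong (complete a) q (λ c p → trans (∑-cong (allFin q) λ x → ℤₚ.*-identityʳ (avoids ⊤ c x)) (∑-avoids a ⊤ c p)) ⟩
    ∑ᶜ (complete a) q (λ _ → + q - + ∣ ⊤ {Graph.order (complete a)} ∣)
      ≡⟨ ∑ᶜ-*ʳ (complete a) q _ ⟩
    ∑ᶜ (complete a) q (λ _ → 1ℤ) * (+ q - + ∣ ⊤ {Graph.order (complete a)} ∣)
      ≡⟨ cong₂ (λ x y → x * (+ q - + y)) (∑ᶜ-complete a q) (trans (∣⊤∣≡n _) (order-complete a)) ⟩
    fallingFactorial (+ q) (suc a) ∎

  -- The leading `true` is the edge between the two vertices outside the clique.
  cliqueWithEdge : ∀ a (N M : Subset (Graph.order (complete a))) → Graph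
  cliqueWithEdge a N M = cone (cone (complete a) M) (true ∷ N)

  -- If the first vertex has colour y, the second has q - ∣N∣ choices, less one exactly when y is
  -- not already excluded by `N`. Over all y allowed by `M`, the loss is the number of colours
  -- allowed by both sets, that is, by `M ∪ N`.
  numProperColourings-cliqueWithEdge : ∀ a N M q → + numProperColourings (cliqueWithEdge a N M) q ≡
    fallingFactorial (+ q) a * ((+ q - + ∣ N ∣) * (+ q - + ∣ M ∣) - (+ q - + ∣ M ∪ N ∣))
  numProperColourings-cliqueWithEdge a N M q = begin
    + numProperColourings (cliqueWithEdge a N M) q
      ≡⟨ numProperColourings-∑ᶜ (cliqueWithEdge a N M) q ⟩
    ∑ᶜ (cliqueWithEdge a N M) q (λ _ → 1ℤ)
      ≡⟨ ∑ᶜ-cone (cone (complete a) M) (true ∷ N) q (λ _ → 1ℤ) ⟩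
    ∑ᶜ (cone (complete a) M) q (λ d → ∑ (allFin q) (λ x → avoids (true ∷ N) d x * 1ℤ))
      ≡⟨ ∑ᶜ-cone (complete a) M q (λ d → ∑ (allFin q) (λ x → avoids (true ∷ N) d x * 1ℤ)) ⟩
    ∑ᶜ (complete a) q (λ c → ∑ (allFin q) (λ y → avoids M c y * ∑ (allFin q) (λ x → avoids (true ∷ N) (y ∷ c) x * 1ℤ)))
      ≡⟨ ∑ᶜ-cong (complete a) q extensions ⟩
    ∑ᶜ (complete a) q (λ _ → (+ q - + ∣ N ∣) * (+ q - + ∣ M ∣) - (+ q - + ∣ M ∪ N ∣))
      ≡⟨ ∑ᶜ-*ʳ (complete a) q _ ⟩
    ∑ᶜ (complete a) q (λ _ → 1ℤ) * ((+ q - + ∣ N ∣) * (+ q - + ∣ M ∣) - (+ q - + ∣ M ∪ N ∣))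
      ≡⟨ cong (_* ((+ q - + ∣ N ∣) * (+ q - + ∣ M ∣) - (+ q - + ∣ M ∪ N ∣))) (∑ᶜ-complete a q) ⟩
    fallingFactorial (+ q) a * ((+ q - + ∣ N ∣) * (+ q - + ∣ M ∣) - (+ q - + ∣ M ∪ N ∣)) ∎
    where
    distrib : ∀ m k n → m * (k - n) ≡ k * m - m * n
    distrib = solve-∀
    extensions : ∀ c → Proper (complete a) c →
      ∑ (allFin q) (λ y → avoids M c y * ∑ (allFin q) (λ x → avoids (true ∷ N) (y ∷ c) x * 1ℤ)) ≡
      (+ q - + ∣ N ∣) * (+ q - + ∣ M ∣) - (+ q - + ∣ M ∪ N ∣)
    extensions c p = begin
      ∑ (allFin q) (λ y → avoids M c y * ∑ (allFin q) (λ x → avoids (true ∷ N) (y ∷ c) x * 1ℤ))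
        ≡⟨ ∑-cong (allFin q) (λ y → cong (avoids M c y *_)
             (trans (∑-cong (allFin q) λ x → ℤₚ.*-identityʳ _)
             (trans (∑-avoids-remove y N c) (cong (_- avoids N c y) (∑-avoids a N c p))))) ⟩
      ∑ (allFin q) (λ y → avoids M c y * (+ q - + ∣ N ∣ - avoids N c y))
        ≡⟨ ∑-cong (allFin q) (λ y → trans (distrib (avoids M c y) (+ q - + ∣ N ∣) (avoids N c y))
             (cong (λ z → (+ q - + ∣ N ∣) * avoids M c y - z) (avoids-∪ M N c y))) ⟩
      ∑ (allFin q) (λ y → (+ q - + ∣ N ∣) * avoids M c y - avoids (M ∪ N) c y)
        ≡⟨ ∑-- (allFin q) _ (avoids (M ∪ N) c) ⟩
      ∑ (allFin q) (λ y → (+ q - + ∣ N ∣) * avoids M c y) - ∑ (allFin q) (avoids (M ∪ N) c)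
        ≡⟨ cong₂ _-_ (trans (∑-*ˡ (allFin q) (+ q - + ∣ N ∣) (avoids M c)) (cong (_*_ (+ q - + ∣ N ∣)) (∑-avoids a M c p)))
                     (∑-avoids a (M ∪ N) c p) ⟩
      (+ q - + ∣ N ∣) * (+ q - + ∣ M ∣) - (+ q - + ∣ M ∪ N ∣) ∎

  -- w vertices lie in both sets, s in `M` only, t in `N` only, and none outside. The recursion
  -- follows `w + (s + t)`, so that the order of the clique unfolds along with it.
  subsets : ∀ w s t → ∃[ N ] ∃[ M ]
    (∣ N ∣ ≡ w ℕ.+ t) × (∣ M ∣ ≡ w ℕ.+ s) × (∣_∣ {Graph.order (complete (w ℕ.+ (s ℕ.+ t)))} (M ∪ N) ≡ w ℕ.+ (s ℕ.+ t))
  subsets (suc w) s t = let N , M , n , m , u = subsets w s t in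
    true ∷ N , true ∷ M , cong suc n , cong suc m , cong suc u
  subsets zero (suc s) t = let N , M , n , m , u = subsets zero s t in
    false ∷ N , true ∷ M , n , cong suc m , cong suc u
  subsets zero zero (suc t) = let N , M , n , m , u = subsets zero zero t in
    true ∷ N , false ∷ M , cong suc n , m , cong suc u
  subsets zero zero zero = [] , [] , refl , refl , refl

-- Coefficient lists of the chromatic polynomials, and the choice of parameters.

module Polynomials where
  open import Data.Fin.Subset using (_∪_; ∣_∣)
  open import Data.Integer using (ℤ; +_; -[1+_]; 0ℤ; 1ℤ; _+_; _*_; _-_; -_)
  import Data.Integer.Properties as ℤₚ
  open import Data.Integer.Tactic.RingSolver using (solve-∀)
  open import Data.List using ([]; _∷_)
  open import Data.Nat as ℕ using (ℕ; zero; suc)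
  open import Data.Product using (∃-syntax; _×_; _,_)
  open import Relation.Binary.PropositionalEquality using (_≡_; refl; sym; trans; cong; cong₂; module ≡-Reasoning)
  open import Defs using (ℤ[X]; evalℤ; IsChromaticPolynomial; numProperColourings)
  open Counting
  open ≡-Reasoning

  infixl 7 _⊛[X-_]+_
  -- p (X - k) + c. The constant c serves as a carry: a coefficient a of p contributes - k a in its
  -- own degree and a in the next.
  _⊛[X-_]+_ : ℤ[X] → ℤ → ℤ → ℤ[X]
  []      ⊛[X- k ]+ c = c ∷ []
  (a ∷ p) ⊛[X- k ]+ c = (c - k * a) ∷ p ⊛[X- k ]+ a

  eval-⊛ : ∀ p k c x → evalℤ (p ⊛[X- k ]+ c) x ≡ (x - k) * evalℤ p x + c
  eval-⊛ []      k c x = identity k c x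
    where
    identity : ∀ k c x → c + x * 0ℤ ≡ (x - k) * 0ℤ + c
    identity = solve-∀
  eval-⊛ (a ∷ p) k c x = trans (cong (λ z → c - k * a + x * z) (eval-⊛ p k a x)) (identity a k c x (evalℤ p x))
    where
    identity : ∀ a k c x v → c - k * a + x * ((x - k) * v + a) ≡ (x - k) * (a + x * v) + c
    identity = solve-∀

  falling⊛ : ℕ → ℤ[X] → ℤ[X]
  falling⊛ zero    p = p
  falling⊛ (suc a) p = falling⊛ a p ⊛[X- + a ]+ 0ℤ

  eval-falling⊛ : ∀ a p x → evalℤ (falling⊛ a p) x ≡ fallingFactorial x a * evalℤ p x
  eval-falling⊛ zero    p x = sym (ℤₚ.*-identityˡ (evalℤ p x))
  eval-falling⊛ (suc a) p x = trans (eval-⊛ (falling⊛ a p) (+ a) 0ℤ x)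
    (trans (cong (λ z → (x - + a) * z + 0ℤ) (eval-falling⊛ a p x)) (identity (x - + a) (fallingFactorial x a) (evalℤ p x)))
    where
    identity : ∀ y f v → y * (f * v) + 0ℤ ≡ f * y * v
    identity = solve-∀

  edgeFactor : ℤ → ℤ → ℤ → ℤ[X]
  edgeFactor n m u = (n * m + u) ∷ - (n + m + 1ℤ) ∷ 1ℤ ∷ []

  eval-edgeFactor : ∀ n m u x → evalℤ (edgeFactor n m u) x ≡ (x - n) * (x - m) - (x - u)
  eval-edgeFactor = identity
    where
    identity : ∀ n m u x → n * m + u + x * (- (n + m + 1ℤ) + x * (1ℤ + x * 0ℤ)) ≡ (x - n) * (x - m) - (x - u)
    identity = solve-∀

  cliqueWithEdgePolynomial : ℕ → ℕ → ℕ → ℤ[X]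
  cliqueWithEdgePolynomial w s t = falling⊛ (w ℕ.+ (s ℕ.+ t)) (edgeFactor (+ (w ℕ.+ t)) (+ (w ℕ.+ s)) (+ (w ℕ.+ (s ℕ.+ t))))

  isChromatic : ∀ w s t → ∃[ G ] IsChromaticPolynomial G (cliqueWithEdgePolynomial w s t)
  isChromatic w s t =
    let N , M , n , m , u = subsets w s t
        a = w ℕ.+ (s ℕ.+ t)
    in cliqueWithEdge a N M , λ q _ → begin
      evalℤ (cliqueWithEdgePolynomial w s t) (+ q)
        ≡⟨ eval-falling⊛ a (edgeFactor (+ (w ℕ.+ t)) (+ (w ℕ.+ s)) (+ a)) (+ q) ⟩
      fallingFactorial (+ q) a * evalℤ (edgeFactor (+ (w ℕ.+ t)) (+ (w ℕ.+ s)) (+ a)) (+ q)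
        ≡⟨ cong (fallingFactorial (+ q) a *_) (eval-edgeFactor (+ (w ℕ.+ t)) (+ (w ℕ.+ s)) (+ a) (+ q)) ⟩
      fallingFactorial (+ q) a * ((+ q - + (w ℕ.+ t)) * (+ q - + (w ℕ.+ s)) - (+ q - + a))
        ≡⟨ cong (fallingFactorial (+ q) a *_) (cong₂ _-_ (cong₂ (λ x y → (+ q - + x) * (+ q - + y)) n m) (cong (λ x → + q - + x) u)) ⟨
      fallingFactorial (+ q) a * ((+ q - + ∣ N ∣) * (+ q - + ∣ M ∣) - (+ q - + ∣ M ∪ N ∣))
        ≡⟨ numProperColourings-cliqueWithEdge a N M q ⟨
      + numProperColourings (cliqueWithEdge a N M) q ∎

  difference : ∀ u → ∃[ a ] ∃[ b ] u ≡ + a - + b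
  difference (+ a)    = a , 0 , sym (ℤₚ.+-identityʳ (+ a))
  difference -[1+ b ] = 0 , suc b , refl

  private
    s-identity : ∀ a b c d {w s} → w ≡ 1ℤ + (a + c) → s ≡ w * (b + c) + (1ℤ + (a + d)) →
      s ≡ w * w - (a - b) * w - (c - d)
    s-identity a b c d refl refl = identity a b c d
      where
      identity : ∀ a b c d → (1ℤ + (a + c)) * (b + c) + (1ℤ + (a + d)) ≡
        (1ℤ + (a + c)) * (1ℤ + (a + c)) - (a - b) * (1ℤ + (a + c)) - (c - d)
      identity = solve-∀

    t-identity : ∀ a b c {w s t} → w ≡ 1ℤ + (a + c) → t ≡ s + (b + c + (w + + 2)) → t ≡ s + (w + w + 1ℤ - (a - b))
    t-identity a b c {s = s} refl refl = identity a b c s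
      where
      identity : ∀ a b c s → s + (b + c + (1ℤ + (a + c) + + 2)) ≡ s + (1ℤ + (a + c) + (1ℤ + (a + c)) + 1ℤ - (a - b))
      identity = solve-∀

  -- Any sufficiently large w works; this one makes s and t visibly natural numbers.
  parameters : ∀ u v → ∃[ w ] ∃[ s ] ∃[ t ]
    (+ s ≡ + w * + w - u * + w - v) × (+ t ≡ + s + (+ w + + w + 1ℤ - u))
  parameters u v with difference u | difference v
  ... | a , b , refl | c , d , refl = w , s , s ℕ.+ (b ℕ.+ c ℕ.+ (w ℕ.+ 2)) ,
      s-identity (+ a) (+ b) (+ c) (+ d) {+ w} {+ s} refl
        (cong (_+ (1ℤ + (+ a + + d))) (ℤₚ.pos-* w (b ℕ.+ c))) ,
      t-identity (+ a) (+ b) (+ c) {+ w} {+ s} refl refl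
    where
    -- For u = a - b and v = c - d this gives w - u = 1 + b + c, hence w (w - u) - v = w (b + c) +
    -- (w - c) + d with w - c = 1 + a.
    w = suc (a ℕ.+ c)
    s = w ℕ.* (b ℕ.+ c) ℕ.+ suc (a ℕ.+ d)

-- Gauss's lemma for a quadratic divisor of a monic polynomial.

module Gauss where
  open import Data.Integer using (ℤ; +_; 0ℤ; 1ℤ; _+_; _*_; _-_; -_) renaming (∣_∣ to abs)
  open import Data.Integer.Divisibility.Signed using (_∣_; divides; quotient; _∣?_; ∣ᵤ⇒∣; ∣⇒∣ᵤ; ∣m∣n⇒∣m-n; ∣m⇒∣m*n; ∣n⇒∣m*n; *-monoˡ-∣)
  import Data.Integer.Properties as ℤₚ
  open import Data.Integer.Tactic.RingSolver using (solve-∀)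
  open import Data.List using ([]; _∷_; length)
  open import Data.List.Relation.Unary.All using (_∷_)
  open import Data.Nat as ℕ using (ℕ; zero; suc; NonZero; s≤s)
  import Data.Nat.Divisibility as ℕ∣
  open import Data.Nat.Induction using (<-rec)
  open import Data.Nat.Primality using (Prime; prime⇒nonZero; prime⇒nonTrivial; euclidsLemma)
  open import Data.Nat.Primality.Factorisation using (factorise)
  import Data.Nat.Properties as ℕₚ
  open import Data.Product using (∃-syntax; _×_; _,_; proj₁; proj₂)
  open import Data.Sum using (inj₁; inj₂)
  open import Relation.Binary.PropositionalEquality using (_≡_; _≢_; refl; sym; trans; cong; cong₂; subst; module ≡-Reasoning)
  open import Relation.Nullary using (¬_; yes; no; contradiction; _×-dec_)
  open import Relation.Nullary.Decidable using (decidable-stable)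
  open import Defs using (ℤ[X]; Monic)
  open ≡-Reasoning

  ∃-prime-divisor : ∀ n → .{{ℕ.NonTrivial n}} → ∃[ l ] Prime l × l ℕ∣.∣ n
  ∃-prime-divisor n@(ℕ.2+ _) with factorise n
  ... | record { factors = [] ; isFactorisation = () }
  ... | record { factors = l ∷ ls ; isFactorisation = eq ; factorsPrime = pl ∷ _ } =
    l , pl , subst (l ℕ∣.∣_) (sym eq) (ℕ∣.m∣m*n _)

  prime-cancel : ∀ {l} → Prime l → ∀ m {n} → ¬ + l ∣ m → + l ∣ m * n → + l ∣ n
  prime-cancel pl m {n} l∤m l∣mn with euclidsLemma (abs m) (abs n) pl (subst (_ ℕ∣.∣_) (ℤₚ.abs-* m n) (∣⇒∣ᵤ l∣mn))
  ... | inj₁ l∣m = contradiction (∣ᵤ⇒∣ l∣m) l∤m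
  ... | inj₂ l∣n = ∣ᵤ⇒∣ l∣n

  quotient-< : ∀ {l e} e′ → Prime l → e ≢ 0ℤ → e ≡ e′ * + l → abs e′ ℕ.< abs e
  quotient-< {l} {e} e′ pl e≢0 e≡e′l = subst (abs e′ ℕ.<_)
    (sym (trans (cong abs e≡e′l) (ℤₚ.abs-* e′ (+ l))))
    (ℕₚ.m<m*n (abs e′) l {{e′≢0}} (ℕ.nonTrivial⇒n>1 l {{prime⇒nonTrivial pl}}))
    where
    e′≢0 : NonZero (abs e′)
    e′≢0 = ℕ.≢-nonZero λ eq → e≢0 (trans e≡e′l (cong (_* + l) (ℤₚ.∣i∣≡0⇒i≡0 {e′} eq)))

  -- The polynomial identity e·p = (t x² − r x − s)·g with deg g ≤ n − 2. The coefficient of xᵏ in g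
  -- is G (2 + k), which makes the identity uniform in k.
  record Factors (p : ℕ → ℤ) (n : ℕ) (t r s e : ℤ) : Set where
    field
      G       : ℕ → ℤ
      G₀      : G 0 ≡ 0ℤ
      G₁      : G 1 ≡ 0ℤ
      G₁₊ₙ    : G (1 ℕ.+ n) ≡ 0ℤ
      G₂₊ₙ    : G (2 ℕ.+ n) ≡ 0ℤ
      product : ∀ k → e * p k ≡ t * G k - r * G (1 ℕ.+ k) - s * G (2 ℕ.+ k)

  open Factors

  module _ {p : ℕ → ℤ} {n : ℕ} (pₙ≡1 : p n ≡ 1ℤ) where

    -- In degree n only the leading term t x² meets a possibly nonzero coefficient of g, and p is
    -- monic. Hence every divisor of t divides e, which drives the descent.
    e≡tG : ∀ {t r s e} (F : Factors p n t r s e) → e ≡ t * G F n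
    e≡tG {t} {r} {s} {e} F = begin
      e                                                    ≡⟨ ℤₚ.*-identityʳ e ⟨
      e * 1ℤ                                               ≡⟨ cong (e *_) pₙ≡1 ⟨
      e * p n                                              ≡⟨ product F n ⟩
      t * G F n - r * G F (1 ℕ.+ n) - s * G F (2 ℕ.+ n)    ≡⟨ cong₂ (λ x y → t * G F n - r * x - s * y) (G₁₊ₙ F) (G₂₊ₙ F) ⟩
      t * G F n - r * 0ℤ - s * 0ℤ                          ≡⟨ simplify (t * G F n) r s ⟩
      t * G F n                                            ∎
      where
      simplify : ∀ a r s → a - r * 0ℤ - s * 0ℤ ≡ a
      simplify = solve-∀

    module _ {l : ℕ} (pl : Prime l) {t r s : ℤ} (l∣t : + l ∣ t) (l∤rs : ¬ (+ l ∣ r × + l ∣ s)) where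

      private
        l∣0 : + l ∣ 0ℤ
        l∣0 = divides 0ℤ refl

      -- Modulo l the identity says (r x + s) g = 0 with r x + s nonzero, so g vanishes. If l does
      -- not divide s, the coefficients of g fall one after another from the bottom, each from the
      -- two before it; if l divides s, then it does not divide r, and every coefficient falls at
      -- once.
      divides-G : ∀ {e} → + l ∣ e → (F : Factors p n t r s e) → ∀ k → + l ∣ G F k
      divides-G {e} l∣e F with + l ∣? s
      ... | no  l∤s = λ k → proj₁ (consecutive k)
        where
        isolate : ∀ a b c → a - b - (a - b - c) ≡ c
        isolate = solve-∀
        consecutive : ∀ k → + l ∣ G F k × + l ∣ G F (suc k)
        consecutive zero    = subst (+ l ∣_) (sym (G₀ F)) l∣0 , subst (+ l ∣_) (sym (G₁ F)) l∣0
        consecutive (suc k) = let l∣Gₖ , l∣G₁₊ₖ = consecutive k in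
          l∣G₁₊ₖ , prime-cancel pl s l∤s
            (subst (+ l ∣_) (trans (cong (λ z → t * G F k - r * G F (suc k) - z) (product F k)) (isolate (t * G F k) (r * G F (suc k)) (s * G F (2 ℕ.+ k))))
              (∣m∣n⇒∣m-n (∣m∣n⇒∣m-n (∣n⇒∣m*n t l∣Gₖ) (∣n⇒∣m*n r l∣G₁₊ₖ)) (∣m⇒∣m*n (p k) l∣e)))
      ... | yes l∣s = λ
        { zero    → subst (+ l ∣_) (sym (G₀ F)) l∣0
        ; (suc k) → prime-cancel pl r (λ l∣r → l∤rs (l∣r , l∣s))
            (subst (+ l ∣_) (trans (cong (λ z → t * G F k - s * G F (2 ℕ.+ k) - z) (product F k)) (isolate (t * G F k) (r * G F (suc k)) (s * G F (2 ℕ.+ k))))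
              (∣m∣n⇒∣m-n (∣m∣n⇒∣m-n (∣m⇒∣m*n (G F k) l∣t) (∣m⇒∣m*n (G F (2 ℕ.+ k)) l∣s)) (∣m⇒∣m*n (p k) l∣e)))
        }
        where
        isolate : ∀ a b c → a - c - (a - b - c) ≡ b
        isolate = solve-∀

      private instance
        l≢0 : NonZero l
        l≢0 = prime⇒nonZero pl

      -- The prime l divides e and all of g, so it cancels from the identity while t, r and s stay
      -- unchanged; the hypotheses hold again for the quotient.
      divide-factors : ∀ {e} → Factors p n t r s e → ∃[ e′ ] e ≡ e′ * + l × Factors p n t r s e′
      divide-factors {e} F = quotient l∣e , _∣_.equality l∣e , record
        { G = λ k → quotient (l∣G k)
        ; G₀ = vanish 0 (G₀ F) ; G₁ = vanish 1 (G₁ F) ; G₁₊ₙ = vanish _ (G₁₊ₙ F) ; G₂₊ₙ = vanish _ (G₂₊ₙ F)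
        ; product = λ k → ℤₚ.*-cancelʳ-≡ _ _ (+ l) (begin
            quotient l∣e * p k * + l    ≡⟨ swap (quotient l∣e) (p k) (+ l) ⟩
            quotient l∣e * + l * p k    ≡⟨ cong (_* p k) (_∣_.equality l∣e) ⟨
            e * p k                     ≡⟨ product F k ⟩
            t * G F k - r * G F (1 ℕ.+ k) - s * G F (2 ℕ.+ k)
              ≡⟨ cong₂ _-_ (cong₂ (λ x y → t * x - r * y) (_∣_.equality (l∣G k)) (_∣_.equality (l∣G (1 ℕ.+ k)))) (cong (s *_) (_∣_.equality (l∣G (2 ℕ.+ k)))) ⟩
            t * (quotient (l∣G k) * + l) - r * (quotient (l∣G (1 ℕ.+ k)) * + l) - s * (quotient (l∣G (2 ℕ.+ k)) * + l)
              ≡⟨ factor t r s (quotient (l∣G k)) (quotient (l∣G (1 ℕ.+ k))) (quotient (l∣G (2 ℕ.+ k))) (+ l) ⟩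
            (t * quotient (l∣G k) - r * quotient (l∣G (1 ℕ.+ k)) - s * quotient (l∣G (2 ℕ.+ k))) * + l ∎)
        }
        where
        l∣e = subst (+ l ∣_) (sym (e≡tG F)) (∣m⇒∣m*n (G F n) l∣t)
        l∣G = divides-G l∣e F
        vanish : ∀ k → G F k ≡ 0ℤ → quotient (l∣G k) ≡ 0ℤ
        vanish k eq = ℤₚ.*-cancelʳ-≡ _ _ (+ l) (trans (sym (_∣_.equality (l∣G k))) eq)
        swap : ∀ a b c → a * b * c ≡ a * c * b
        swap = solve-∀
        factor : ∀ t r s x y z l → t * (x * l) - r * (y * l) - s * (z * l) ≡ (t * x - r * y - s * z) * l
        factor = solve-∀

      -- Infinite descent: e = t · G n is again divisible by l after each division.
      factors⇒e≡0 : ∀ e → Factors p n t r s e → e ≡ 0ℤ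
      factors⇒e≡0 e = <-rec (λ m → ∀ e → abs e ≡ m → Factors p n t r s e → e ≡ 0ℤ) step (abs e) e refl
        where
        step : ∀ m → (∀ {m′} → m′ ℕ.< m → ∀ e → abs e ≡ m′ → Factors p n t r s e → e ≡ 0ℤ) →
               ∀ e → abs e ≡ m → Factors p n t r s e → e ≡ 0ℤ
        -- Equality of integers is decidable, so e ≠ 0 may be assumed; only then is the quotient
        -- strictly smaller.
        step _ rec e refl F = decidable-stable (e ℤₚ.≟ 0ℤ) λ e≢0 →
          let e′ , e≡e′l , F′ = divide-factors F
          in e≢0 (trans e≡e′l (cong (_* + l) (rec (quotient-< e′ pl e≢0 e≡e′l) e′ refl F′)))

    -- Strong induction on t. If a prime l of t did not divide both r and s, descent would give e =
    -- 0. Otherwise l moves from the divisor into the cofactor g, which keeps e and replaces t by t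
    -- / l.
    gauss : ∀ t → .{{NonZero t}} → ∀ {r s e} → e ≢ 0ℤ → Factors p n (+ t) r s e → + t ∣ r × + t ∣ s
    gauss t = <-rec (λ t → .{{NonZero t}} → ∀ {r s e} → e ≢ 0ℤ → Factors p n (+ t) r s e → + t ∣ r × + t ∣ s) step t
      where
      step : ∀ t → (∀ {t′} → t′ ℕ.< t → .{{NonZero t′}} → ∀ {r s e} → e ≢ 0ℤ → Factors p n (+ t′) r s e → + t′ ∣ r × + t′ ∣ s) →
             .{{NonZero t}} → ∀ {r s e} → e ≢ 0ℤ → Factors p n (+ t) r s e → + t ∣ r × + t ∣ s
      step 1 rec {r} {s} _ _ = divides r (sym (ℤₚ.*-identityʳ r)) , divides s (sym (ℤₚ.*-identityʳ s))
      step t@(ℕ.2+ _) rec {r} {s} {e} e≢0 F with ∃-prime-divisor t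
      ... | l , pl , ℕ∣.divides t′ t≡t′l with + l ∣? r ×-dec + l ∣? s
      ...   | no  l∤rs = contradiction (factors⇒e≡0 pl (divides (+ t′) (trans (cong +_ t≡t′l) (ℤₚ.pos-* t′ l))) l∤rs e F) e≢0
      ...   | yes (divides r′ refl , divides s′ refl) =
        subst (λ z → z ∣ r × z ∣ s) (sym +t≡) (*-monoˡ-∣ (+ l) (proj₁ ih) , *-monoˡ-∣ (+ l) (proj₂ ih))
        where
        +t≡ : + t ≡ + t′ * + l
        +t≡ = trans (cong +_ t≡t′l) (ℤₚ.pos-* t′ l)
        instance
          t′≢0 : NonZero t′
          t′≢0 = ℕ.≢-nonZero λ { refl → contradiction t≡t′l λ () }
          _ = prime⇒nonTrivial pl
        regroup : ∀ t r s x y z l → t * l * x - r * l * y - s * l * z ≡ t * (l * x) - r * (l * y) - s * (l * z)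
        regroup = solve-∀
        *0 : ∀ {x} → x ≡ 0ℤ → + l * x ≡ 0ℤ
        *0 refl = ℤₚ.*-zeroʳ (+ l)
        ih = rec (subst (t′ ℕ.<_) (sym t≡t′l) (ℕₚ.m<m*n t′ l (ℕ.nonTrivial⇒n>1 l))) {r′} {s′} {e} e≢0 record
          { G = λ k → + l * G F k
          ; G₀ = *0 (G₀ F) ; G₁ = *0 (G₁ F) ; G₁₊ₙ = *0 (G₁₊ₙ F) ; G₂₊ₙ = *0 (G₂₊ₙ F)
          ; product = λ k → trans (product F k)
              (trans (cong (λ z → z * G F k - r′ * + l * G F (1 ℕ.+ k) - s′ * + l * G F (2 ℕ.+ k)) +t≡)
                     (regroup (+ t′) r′ s′ (G F k) (G F (1 ℕ.+ k)) (G F (2 ℕ.+ k)) (+ l)))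
          }

  coefficient : ℤ[X] → ℕ → ℤ
  coefficient []      k       = 0ℤ
  coefficient (a ∷ p) zero    = a
  coefficient (a ∷ p) (suc k) = coefficient p k

  monic⇒leading≡1 : ∀ p → Monic p → ∃[ n ] length p ≡ suc n × coefficient p n ≡ 1ℤ
  monic⇒leading≡1 (a ∷ [])        refl = 0 , refl , refl
  monic⇒leading≡1 (a ∷ p@(_ ∷ _)) eq   = let n , len , lead = monic⇒leading≡1 p eq in suc n , cong suc len , lead

  -- Division by D = t X² - r X - s inside `ℤ`: `scale p` · p = Q D + `rem₁ p` · X + `rem₀ p`, where
  -- `scale p` is the power of t with exponent `length p` and `quo p k` is the coefficient of Xᵏ in
  -- Q. Passing to a + X p multiplies everything by t, and then m t X² is rewritten as m D + m (r X
  -- + s) for m = `rem₁ p`.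
  module PseudoDivision (t r s : ℤ) where

    scale : ℤ[X] → ℤ
    scale []      = 1ℤ
    scale (a ∷ p) = t * scale p

    rem₀ rem₁ : ℤ[X] → ℤ
    rem₀ []      = 0ℤ
    rem₀ (a ∷ p) = t * scale p * a + s * rem₁ p
    rem₁ []      = 0ℤ
    rem₁ (a ∷ p) = t * rem₀ p + r * rem₁ p

    quo : ℤ[X] → ℕ → ℤ
    quo []      k       = 0ℤ
    quo (a ∷ p) zero    = rem₁ p
    quo (a ∷ p) (suc k) = t * quo p k

    division₀ : ∀ p → scale p * coefficient p 0 ≡ rem₀ p - s * quo p 0
    division₀ []      = sym (zeros s)
      where
      zeros : ∀ s → 0ℤ - s * 0ℤ ≡ 0ℤ
      zeros = solve-∀
    division₀ (a ∷ p) = identity (t * scale p * a) (s * rem₁ p)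
      where
      identity : ∀ x y → x ≡ x + y - y
      identity = solve-∀

    division₁ : ∀ p → scale p * coefficient p 1 ≡ rem₁ p - r * quo p 0 - s * quo p 1
    division₁ []      = sym (zeros r s)
      where
      zeros : ∀ r s → 0ℤ - r * 0ℤ - s * 0ℤ ≡ 0ℤ
      zeros = solve-∀
    division₁ (a ∷ p) = trans (trans (ℤₚ.*-assoc t (scale p) (coefficient p 0)) (cong (t *_) (division₀ p)))
      (identity t r s (rem₀ p) (rem₁ p) (quo p 0))
      where
      identity : ∀ t r s k m g → t * (k - s * g) ≡ t * k + r * m - r * m - s * (t * g)
      identity = solve-∀

    division₂ : ∀ p k → scale p * coefficient p (2 ℕ.+ k) ≡ t * quo p k - r * quo p (1 ℕ.+ k) - s * quo p (2 ℕ.+ k)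
    division₂ []      k       = sym (zeros t r s)
      where
      zeros : ∀ t r s → t * 0ℤ - r * 0ℤ - s * 0ℤ ≡ 0ℤ
      zeros = solve-∀
    division₂ (a ∷ p) zero    = trans (trans (ℤₚ.*-assoc t (scale p) (coefficient p 1)) (cong (t *_) (division₁ p)))
      (identity t r s (rem₁ p) (quo p 0) (quo p 1))
      where
      identity : ∀ t r s m g h → t * (m - r * g - s * h) ≡ t * m - r * (t * g) - s * (t * h)
      identity = solve-∀
    division₂ (a ∷ p) (suc k) = trans (trans (ℤₚ.*-assoc t (scale p) (coefficient p (2 ℕ.+ k))) (cong (t *_) (division₂ p k)))
      (identity t r s (quo p k) (quo p (1 ℕ.+ k)) (quo p (2 ℕ.+ k)))
      where
      identity : ∀ t r s f g h → t * (t * f - r * g - s * h) ≡ t * (t * f) - r * (t * g) - s * (t * h)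
      identity = solve-∀

    quo-degree : ∀ p k → length p ℕ.≤ 2 ℕ.+ k → quo p k ≡ 0ℤ
    quo-degree []          k       _       = refl
    quo-degree (_ ∷ [])    zero    _       = refl
    quo-degree (_ ∷ _ ∷ []) zero   _       = zeros t r
      where
      zeros : ∀ t r → t * 0ℤ + r * 0ℤ ≡ 0ℤ
      zeros = solve-∀
    quo-degree (_ ∷ _ ∷ _ ∷ _) zero (s≤s (s≤s ()))
    quo-degree (_ ∷ p)     (suc k) (s≤s h) = trans (cong (t *_) (quo-degree p k h)) (ℤₚ.*-zeroʳ t)

    scale≢0 : t ≢ 0ℤ → ∀ p → scale p ≢ 0ℤ
    scale≢0 t≢0 []      ()
    scale≢0 t≢0 (a ∷ p) eq with ℤₚ.i*j≡0⇒i≡0∨j≡0 t eq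
    ... | inj₁ t≡0 = t≢0 t≡0
    ... | inj₂ e≡0 = scale≢0 t≢0 p e≡0

    -- With zero remainder, shifting the quotient by two places and padding with zeros merges the
    -- three forms of the division identity into one.
    factors : ∀ p {n} → length p ≡ suc n → rem₀ p ≡ 0ℤ → rem₁ p ≡ 0ℤ → Factors (coefficient p) n t r s (scale p)
    factors p {n} len rem₀≡0 rem₁≡0 = record
      { G = G′ ; G₀ = refl ; G₁ = refl ; G₁₊ₙ = top n len
      ; G₂₊ₙ = quo-degree p n (ℕₚ.≤-trans (ℕₚ.≤-reflexive len) (ℕₚ.n≤1+n (suc n))) ; product = product′ }
      where
      G′ : ℕ → ℤ
      G′ 0             = 0ℤ
      G′ 1             = 0ℤ
      G′ (suc (suc k)) = quo p k
      top : ∀ n → length p ≡ suc n → G′ (suc n) ≡ 0ℤ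
      -- For constant p the entry in question is one of the two padding zeros.
      top zero    _   = refl
      top (suc n) len = quo-degree p n (ℕₚ.≤-reflexive len)
      zeros₀ : ∀ t r x → 0ℤ - x ≡ t * 0ℤ - r * 0ℤ - x
      zeros₀ = solve-∀
      zeros₁ : ∀ t x y → 0ℤ - x - y ≡ t * 0ℤ - x - y
      zeros₁ = solve-∀
      product′ : ∀ k → scale p * coefficient p k ≡ t * G′ k - r * G′ (1 ℕ.+ k) - s * G′ (2 ℕ.+ k)
      product′ 0 = trans (division₀ p) (trans (cong (_- s * quo p 0) rem₀≡0) (zeros₀ t r (s * quo p 0)))
      product′ 1 = trans (division₁ p) (trans (cong (λ z → z - r * quo p 0 - s * quo p 1) rem₁≡0) (zeros₁ t (r * quo p 0) (s * quo p 1)))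
      product′ (suc (suc k)) = division₂ p k

  monic-divisor : ∀ t → .{{NonZero t}} → ∀ {r s} p → Monic p → let open PseudoDivision (+ t) r s in
    rem₀ p ≡ 0ℤ → rem₁ p ≡ 0ℤ → + t ∣ r × + t ∣ s
  monic-divisor t {r} {s} p monic rem₀≡0 rem₁≡0 =
    let n , len , lead = monic⇒leading≡1 p monic
    in gauss lead t (scale≢0 (λ +t≡0 → ℕ.≢-nonZero⁻¹ t (ℤₚ.+-injective +t≡0)) p) (factors p len rem₀≡0 rem₁≡0)
    where open PseudoDivision (+ t) r s

-- Fractions with denominator 1, and Cramer's rule for two unknowns.

module Rationals where
  open import Data.Integer as ℤ using (ℤ; +_; 0ℤ)
  import Data.Integer.Properties as ℤₚ
  open import Data.Integer.Tactic.RingSolver using (solve-∀)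
  open import Data.Rational using (ℚ; 0ℚ; 1ℚ; _/_; _+_; _*_; -_; _-_; 1/_; ↥_; ↧_; toℚᵘ; mkℚ; ≢-nonZero)
  open import Data.Rational.Solver using (module +-*-Solver)
  open import Data.Rational.Properties
  open import Data.Rational.Unnormalised as ℚᵘ using (mkℚᵘ; *≡*)
  import Data.Rational.Unnormalised.Properties as ℚᵘₚ
  open import Data.Product using (_×_; _,_)
  open import Relation.Binary.PropositionalEquality using (_≡_; _≢_; refl; sym; trans; cong)

  toℚᵘ-/1 : ∀ k → toℚᵘ (k / 1) ℚᵘ.≃ mkℚᵘ k 0
  toℚᵘ-/1 k = toℚᵘ-fromℚᵘ (mkℚᵘ k 0)

  /1-homo-+ : ∀ a b → (a ℤ.+ b) / 1 ≡ a / 1 + b / 1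
  /1-homo-+ a b = toℚᵘ-injective (ℚᵘₚ.≃-trans (toℚᵘ-/1 (a ℤ.+ b)) (ℚᵘₚ.≃-sym (ℚᵘₚ.≃-trans
    (toℚᵘ-homo-+ (a / 1) (b / 1)) (ℚᵘₚ.≃-trans (ℚᵘₚ.+-cong (toℚᵘ-/1 a) (toℚᵘ-/1 b)) (*≡* (identity a b))))))
    where
    identity : ∀ a b → (a ℤ.* + 1 ℤ.+ b ℤ.* + 1) ℤ.* + 1 ≡ (a ℤ.+ b) ℤ.* + 1
    identity = solve-∀

  /1-homo-* : ∀ a b → (a ℤ.* b) / 1 ≡ a / 1 * (b / 1)
  /1-homo-* a b = toℚᵘ-injective (ℚᵘₚ.≃-trans (toℚᵘ-/1 (a ℤ.* b)) (ℚᵘₚ.≃-sym (ℚᵘₚ.≃-trans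
    (toℚᵘ-homo-* (a / 1) (b / 1)) (ℚᵘₚ.*-cong (toℚᵘ-/1 a) (toℚᵘ-/1 b)))))

  /1-homo-neg : ∀ a → (ℤ.- a) / 1 ≡ - (a / 1)
  /1-homo-neg a = toℚᵘ-injective (ℚᵘₚ.≃-trans (toℚᵘ-/1 (ℤ.- a)) (ℚᵘₚ.≃-sym (ℚᵘₚ.≃-trans
    (toℚᵘ-homo‿- (a / 1)) (ℚᵘₚ.-‿cong (toℚᵘ-/1 a)))))

  /1≡0 : ∀ a → a / 1 ≡ 0ℚ → a ≡ 0ℤ
  /1≡0 a eq with fromℚᵘ-injective {mkℚᵘ a 0} {mkℚᵘ 0ℤ 0} eq
  ... | *≡* eq′ = trans (sym (ℤₚ.*-identityʳ a)) eq′

  ↧*≡↥ : ∀ p → ↧ p / 1 * p ≡ ↥ p / 1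
  ↧*≡↥ p = toℚᵘ-injective (ℚᵘₚ.≃-trans (toℚᵘ-homo-* (↧ p / 1) p) (ℚᵘₚ.≃-trans
    (ℚᵘₚ.*-congʳ {toℚᵘ p} (toℚᵘ-/1 (↧ p))) (ℚᵘₚ.≃-trans (lemma p) (ℚᵘₚ.≃-sym (toℚᵘ-/1 (↥ p))))))
    where
    identity : ∀ n d → d ℤ.* n ℤ.* + 1 ≡ n ℤ.* (+ 1 ℤ.* d)
    identity = solve-∀
    lemma : ∀ p → mkℚᵘ (↧ p) 0 ℚᵘ.* toℚᵘ p ℚᵘ.≃ mkℚᵘ (↥ p) 0
    lemma p@(mkℚ n _ _) = *≡* (identity n (↧ p))

  *-zero-cancelʳ : ∀ p {q} → q ≢ 0ℚ → p * q ≡ 0ℚ → p ≡ 0ℚ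
  *-zero-cancelʳ p {q} q≢0 pq≡0 = trans (sym (*-identityʳ p)) (trans (cong (p *_) (sym (*-inverseʳ q)))
    (trans (sym (*-assoc p q (1/ q))) (trans (cong (_* 1/ q) pq≡0) (*-zeroˡ (1/ q)))))
    where instance _ = ≢-nonZero q≢0

  module _ (a b c d : ℚ) where

    -- The matrix has columns (a, c) and (b, d), the coordinate vectors of two elements.
    det : ℚ
    det = a * d - c * b

    det≢0⇒trivial : det ≢ 0ℚ → ∀ {x y} → x * a + y * b ≡ 0ℚ → x * c + y * d ≡ 0ℚ → x ≡ 0ℚ × y ≡ 0ℚ
    det≢0⇒trivial det≢0 {x} {y} e₁ e₂ = cancel (trans eliminate-y (vanish d b e₁ e₂)) , cancel (trans eliminate-x (vanish a c e₂ e₁))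
      where
      open +-*-Solver
      eliminate-y : x * det ≡ d * (x * a + y * b) - b * (x * c + y * d)
      eliminate-y = solve 6 (λ x y a b c d → x :* (a :* d :- c :* b) := d :* (x :* a :+ y :* b) :- b :* (x :* c :+ y :* d)) refl x y a b c d
      eliminate-x : y * det ≡ a * (x * c + y * d) - c * (x * a + y * b)
      eliminate-x = solve 6 (λ x y a b c d → y :* (a :* d :- c :* b) := a :* (x :* c :+ y :* d) :- c :* (x :* a :+ y :* b)) refl x y a b c d
      vanish : ∀ p q {u v} → u ≡ 0ℚ → v ≡ 0ℚ → p * u - q * v ≡ 0ℚ
      vanish p q refl refl = solve 2 (λ p q → p :* con 0ℚ :- q :* con 0ℚ := con 0ℚ) refl p q
      cancel : ∀ {z} → z * det ≡ 0ℚ → z ≡ 0ℚ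
      cancel {z} = *-zero-cancelʳ z det≢0

    -- The inverse of the determinant enters as a variable i, so that the identities to be checked
    -- are polynomial.
    cramer : ∀ e f i → i * det ≡ 1ℚ →
      (i * (e * d - f * b) * a + i * (a * f - c * e) * b ≡ e) × (i * (e * d - f * b) * c + i * (a * f - c * e) * d ≡ f)
    cramer e f i inverse =
        trans (solve 7 (λ i a b c d e f → i :* (e :* d :- f :* b) :* a :+ i :* (a :* f :- c :* e) :* b := i :* (a :* d :- c :* b) :* e) refl i a b c d e f) (cancel-det e)
      , trans (solve 7 (λ i a b c d e f → i :* (e :* d :- f :* b) :* c :+ i :* (a :* f :- c :* e) :* d := i :* (a :* d :- c :* b) :* f) refl i a b c d e f) (cancel-det f)
      where
      open +-*-Solver
      cancel-det : ∀ x → i * det * x ≡ x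
      cancel-det x = trans (cong (_* x) inverse) (*-identityˡ x)

-- Quadratic integers in a commutative ring that receives the rationals.

module RationalAlgebra (R : CommutativeRing 0ℓ 0ℓ)
  (φ : Data.Rational.+-*-rawRing -Raw-AlmostCommutative⟶ fromCommutativeRing R) where

  open import Data.Integer as ℤ using (ℤ; +_; 0ℤ; 1ℤ)
  import Data.Integer.Divisibility.Signed as ℤ∣
  import Data.Integer.Properties as ℤₚ
  open import Data.Integer.Tactic.RingSolver using (solve-∀)
  open import Data.List using ([]; _∷_; map)
  import Data.Maybe as Maybe
  open import Data.Nat as ℕ using (ℕ; zero; suc)
  import Data.Nat.Properties as ℕₚ
  open import Data.Product using (∃-syntax; _×_; _,_; proj₁; proj₂)
  open import Data.Rational as ℚ using (ℚ; 0ℚ; 1ℚ; _/_; 1/_; ↥_; ↧_; ↧ₙ_)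
  import Data.Rational.Properties as ℚₚ
  open import Data.Rational.Solver using (module +-*-Solver)
  open import Function using (case_of_)
  open import Relation.Binary.PropositionalEquality as ≡ using (_≡_; _≢_)
  open import Relation.Nullary using (yes; no; contradiction)
  open import Relation.Nullary.Decidable using (dec⇒maybe)
  open import Defs using (ℤ[X]; Monic; evalIn)
  open CommutativeRing R
  open _-Raw-AlmostCommutative⟶_ φ
  open Rationals
  open Gauss
  open import Relation.Binary.Reasoning.Setoid setoid

  ⟦⟧-cong : ∀ {p q} → p ≡ q → ⟦ p ⟧ ≈ ⟦ q ⟧
  ⟦⟧-cong p≡q = reflexive (≡.cong ⟦_⟧ p≡q)

  module Solver where
    open import Algebra.Solver.Ring ℚ.+-*-rawRing (fromCommutativeRing R) φ (λ p q → Maybe.map ⟦⟧-cong (dec⇒maybe (p ℚₚ.≟ q))) public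
  open Solver using (solve; con; _:+_; _:*_; _:-_; :-_; _:=_)

  ι : ℤ → Carrier
  ι k = ⟦ k / 1 ⟧

  ι-cong : ∀ {a b} → a ≡ b → ι a ≈ ι b
  ι-cong eq = reflexive (≡.cong ι eq)

  ι-+ : ∀ a b → ι (a ℤ.+ b) ≈ ι a + ι b
  ι-+ a b = trans (⟦⟧-cong (/1-homo-+ a b)) (+-homo (a / 1) (b / 1))

  ι-* : ∀ a b → ι (a ℤ.* b) ≈ ι a * ι b
  ι-* a b = trans (⟦⟧-cong (/1-homo-* a b)) (*-homo (a / 1) (b / 1))

  ι-neg : ∀ a → ι (ℤ.- a) ≈ - ι a
  ι-neg a = trans (⟦⟧-cong (/1-homo-neg a)) (-‿homo (a / 1))

  ι-- : ∀ a b → ι (a ℤ.- b) ≈ ι a - ι b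
  ι-- a b = trans (ι-+ a (ℤ.- b)) (+-congˡ (ι-neg b))

  eval : ℤ[X] → Carrier → Carrier
  eval p = evalIn rawRing (map ι p)

  module _ {t r s : ℤ} {α : Carrier} (root : ι t * (α * α) ≈ ι r * α + ι s) where
    open PseudoDivision t r s

    -- The pseudo-division identity at α, where the divisor vanishes. It is proved along the same
    -- recursion, so the quotient never has to be evaluated.
    eval-rem : ∀ p → ι (scale p) * eval p α ≈ ι (rem₀ p) + ι (rem₁ p) * α
    eval-rem []      = begin
      ι 1ℤ * 0#          ≈⟨ zeroʳ (ι 1ℤ) ⟩
      0#                 ≈⟨ +-identityʳ 0# ⟨
      0# + 0#            ≈⟨ +-cong 0-homo (zeroˡ α) ⟨
      ι 0ℤ + 0# * α      ≈⟨ +-congˡ (*-congʳ 0-homo) ⟨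
      ι 0ℤ + ι 0ℤ * α    ∎
    eval-rem (a ∷ p) = begin
      ι (t ℤ.* scale p) * (ι a + α * eval p α)
        ≈⟨ *-congʳ (ι-* t (scale p)) ⟩
      ι t * ι (scale p) * (ι a + α * eval p α)
        ≈⟨ solve 5 (λ t e a x v → t :* e :* (a :+ x :* v) := t :* e :* a :+ t :* x :* (e :* v)) refl (ι t) (ι (scale p)) (ι a) α (eval p α) ⟩
      ι t * ι (scale p) * ι a + ι t * α * (ι (scale p) * eval p α)
        ≈⟨ +-congˡ (*-congˡ (eval-rem p)) ⟩
      ι t * ι (scale p) * ι a + ι t * α * (k + m * α)
        ≈⟨ solve 6 (λ t e a x k m → t :* e :* a :+ t :* x :* (k :+ m :* x) := t :* e :* a :+ t :* k :* x :+ m :* (t :* (x :* x))) refl (ι t) (ι (scale p)) (ι a) α k m ⟩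
      ι t * ι (scale p) * ι a + ι t * k * α + m * (ι t * (α * α))
        ≈⟨ +-congˡ (*-congˡ root) ⟩
      ι t * ι (scale p) * ι a + ι t * k * α + m * (ι r * α + ι s)
        ≈⟨ solve 7 (λ y t x k m r s → y :+ t :* k :* x :+ m :* (r :* x :+ s) := y :+ s :* m :+ (t :* k :+ r :* m) :* x) refl (ι t * ι (scale p) * ι a) (ι t) α k m (ι r) (ι s) ⟩
      ι t * ι (scale p) * ι a + ι s * m + (ι t * k + ι r * m) * α
        ≈⟨ +-cong (+-cong (*-congʳ (ι-* t (scale p))) (ι-* s (rem₁ p))) (*-congʳ (+-cong (ι-* t (rem₀ p)) (ι-* r (rem₁ p)))) ⟨
      ι (t ℤ.* scale p) * ι a + ι (s ℤ.* rem₁ p) + (ι (t ℤ.* rem₀ p) + ι (r ℤ.* rem₁ p)) * α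
        ≈⟨ +-cong (+-congʳ (ι-* (t ℤ.* scale p) a)) (*-congʳ (ι-+ (t ℤ.* rem₀ p) (r ℤ.* rem₁ p))) ⟨
      ι (t ℤ.* scale p ℤ.* a) + ι (s ℤ.* rem₁ p) + ι (rem₁ (a ∷ p)) * α
        ≈⟨ +-congʳ (ι-+ (t ℤ.* scale p ℤ.* a) (s ℤ.* rem₁ p)) ⟨
      ι (rem₀ (a ∷ p)) + ι (rem₁ (a ∷ p)) * α ∎
      where
      k = ι (rem₀ p)
      m = ι (rem₁ p)

    eval-rem≈0 : ∀ p → eval p α ≈ 0# → ι (rem₀ p) + ι (rem₁ p) * α ≈ 0#
    eval-rem≈0 p root-p = trans (sym (eval-rem p)) (trans (*-congˡ root-p) (zeroʳ _))

  IsQuadraticInteger : Carrier → Set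
  IsQuadraticInteger α = ∃[ u ] ∃[ v ] α * α ≈ ι u * α + ι v

  divide-root : ∀ t → .{{ℕ.NonZero t}} → ∀ {r s α} → ι (+ t) * (α * α) ≈ ι r * α + ι s →
    + t ℤ∣.∣ r × + t ℤ∣.∣ s → IsQuadraticInteger α
  divide-root t {r} {s} {α} root (ℤ∣.divides u ≡.refl , ℤ∣.divides v ≡.refl) = u , v , (begin
    α * α                                    ≈⟨ *-identityˡ (α * α) ⟨
    1# * (α * α)                             ≈⟨ *-congʳ inverse ⟨
    c * ι (+ t) * (α * α)                    ≈⟨ *-assoc c (ι (+ t)) (α * α) ⟩
    c * (ι (+ t) * (α * α))                  ≈⟨ *-congˡ root ⟩
    c * (ι (u ℤ.* + t) * α + ι (v ℤ.* + t))  ≈⟨ *-congˡ (+-cong (*-congʳ (ι-* u (+ t))) (ι-* v (+ t))) ⟩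
    c * (ι u * ι (+ t) * α + ι v * ι (+ t))  ≈⟨ solve 5 (λ c t u v a → c :* (u :* t :* a :+ v :* t) := c :* t :* (u :* a :+ v)) refl c (ι (+ t)) (ι u) (ι v) α ⟩
    c * ι (+ t) * (ι u * α + ι v)            ≈⟨ *-congʳ inverse ⟩
    1# * (ι u * α + ι v)                     ≈⟨ *-identityˡ _ ⟩
    ι u * α + ι v                            ∎)
    where
    instance _ = ℚ.≢-nonZero λ eq → ℕ.≢-nonZero⁻¹ t (ℤₚ.+-injective (/1≡0 (+ t) eq))
    c = ⟦ 1/ (+ t / 1) ⟧
    inverse : c * ι (+ t) ≈ 1#
    inverse = trans (sym (*-homo (1/ (+ t / 1)) (+ t / 1))) (trans (⟦⟧-cong (ℚₚ.*-inverseˡ (+ t / 1))) 1-homo)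

  module _ (injective : ∀ z → ⟦ z ⟧ ≈ 0# → z ≡ 0ℚ) {α : Carrier} {z : ℚ} (α≈z : α ≈ ⟦ z ⟧) where

    module _ (z≢0 : z ≢ 0ℚ) {t r : ℤ} (root : ι t * (α * α) ≈ ι r * α + ι 0ℤ) (p : ℤ[X]) (root-p : eval p α ≈ 0#) where
      open PseudoDivision t r 0ℤ

      rem₀-X* : rem₀ (0ℤ ∷ p) ≡ 0ℤ
      rem₀-X* = zeros (t ℤ.* scale p) (rem₁ p)
        where
        zeros : ∀ a b → a ℤ.* 0ℤ ℤ.+ 0ℤ ℤ.* b ≡ 0ℤ
        zeros = solve-∀

      -- The remainder of X p is m X, so evaluation gives m z = 0 in `ℚ`, and z ≠ 0 can be
      -- cancelled.
      rem₁-X* : rem₁ (0ℤ ∷ p) ≡ 0ℤ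
      rem₁-X* = /1≡0 m (*-zero-cancelʳ (m / 1) z≢0 (injective (m / 1 ℚ.* z) (begin
        ⟦ m / 1 ℚ.* z ⟧                   ≈⟨ *-homo (m / 1) z ⟩
        ι m * ⟦ z ⟧                       ≈⟨ *-congˡ α≈z ⟨
        ι m * α                           ≈⟨ +-identityˡ (ι m * α) ⟨
        0# + ι m * α                      ≈⟨ +-congʳ (trans (ι-cong rem₀-X*) 0-homo) ⟨
        ι (rem₀ (0ℤ ∷ p)) + ι m * α       ≈⟨ eval-rem≈0 {t} {r} {0ℤ} root (0ℤ ∷ p) root-X*p ⟩
        0#                                ∎)))
        where
        m = rem₁ (0ℤ ∷ p)
        root-X*p : ι 0ℤ + α * eval p α ≈ 0#
        root-X*p = trans (+-cong 0-homo (trans (*-congˡ root-p) (zeroʳ α))) (+-identityʳ 0#)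

    monic-X* : ∀ p → Monic p → Monic (0ℤ ∷ p)
    monic-X* (_ ∷ _) monic = monic

    rational-root : ι (↧ z) * (α * α) ≈ ι (↥ z) * α + ι 0ℤ
    rational-root = begin
      ι (↧ z) * (α * α)       ≈⟨ *-assoc (ι (↧ z)) α α ⟨
      ι (↧ z) * α * α         ≈⟨ *-congʳ (*-congˡ α≈z) ⟩
      ι (↧ z) * ⟦ z ⟧ * α     ≈⟨ *-congʳ (*-homo (↧ z / 1) z) ⟨
      ⟦ ↧ z / 1 ℚ.* z ⟧ * α   ≈⟨ *-congʳ (⟦⟧-cong (↧*≡↥ z)) ⟩
      ι (↥ z) * α             ≈⟨ +-identityʳ (ι (↥ z) * α) ⟨
      ι (↥ z) * α + 0#        ≈⟨ +-congˡ 0-homo ⟨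
      ι (↥ z) * α + ι 0ℤ      ∎

    -- A rational number r/t is a root of t X² − r X, which divides X·p.
    rational⇒quadraticInteger : ∀ p → Monic p → eval p α ≈ 0# → IsQuadraticInteger α
    rational⇒quadraticInteger p monic root-p = case z ℚₚ.≟ 0ℚ of λ
      -- Here z cannot be cancelled, but α is 0 and X² serves as its polynomial.
      { (yes z≡0) → 0ℤ , 0ℤ , (begin
          α * α              ≈⟨ *-congʳ (trans α≈z (⟦⟧-cong z≡0)) ⟩
          ι 0ℤ * α           ≈⟨ +-identityʳ (ι 0ℤ * α) ⟨
          ι 0ℤ * α + 0#      ≈⟨ +-congˡ 0-homo ⟨
          ι 0ℤ * α + ι 0ℤ    ∎)
      ; (no z≢0) → divide-root (↧ₙ z) {↥ z} {0ℤ} rational-root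
          (monic-divisor (↧ₙ z) {↥ z} {0ℤ} (0ℤ ∷ p) (monic-X* p monic)
            (rem₀-X* z≢0 {↧ z} {↥ z} rational-root p root-p) (rem₁-X* z≢0 {↧ z} {↥ z} rational-root p root-p))
      }

  -- Independence of 1 and α over `ℤ` makes both coefficients of the remainder vanish.
  irrational⇒quadraticInteger : ∀ {α} → (∀ k m → ι k + ι m * α ≈ 0# → k ≡ 0ℤ × m ≡ 0ℤ) →
    ∀ a b → α * α ≈ ⟦ a ⟧ + ⟦ b ⟧ * α → ∀ p → Monic p → eval p α ≈ 0# → IsQuadraticInteger α
  irrational⇒quadraticInteger {α} independent a b square p monic root-p =
    divide-root t {r} {s} root (monic-divisor t {r} {s} p monic (proj₁ rem≡0) (proj₂ rem≡0))
    where
    -- The product of the denominators suffices: `gauss` does not ask for a relation in lowest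
    -- terms.
    t = ↧ₙ a ℕ.* ↧ₙ b
    instance
      t≢0 : ℕ.NonZero t
      t≢0 = ℕₚ.m*n≢0 (↧ₙ a) (↧ₙ b)
    r = ↧ a ℤ.* ↥ b
    s = ↥ a ℤ.* ↧ b
    clear : ∀ c → ι (↧ c) * ⟦ c ⟧ ≈ ι (↥ c)
    clear c = trans (sym (*-homo (↧ c / 1) c)) (⟦⟧-cong (↧*≡↥ c))
    root : ι (+ t) * (α * α) ≈ ι r * α + ι s
    root = begin
      ι (+ t) * (α * α)
        ≈⟨ *-cong (trans (ι-cong (ℤₚ.pos-* (↧ₙ a) (↧ₙ b))) (ι-* (↧ a) (↧ b))) square ⟩
      ι (↧ a) * ι (↧ b) * (⟦ a ⟧ + ⟦ b ⟧ * α)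
        ≈⟨ solve 5 (λ d e a b x → d :* e :* (a :+ b :* x) := d :* (e :* b) :* x :+ d :* a :* e) refl (ι (↧ a)) (ι (↧ b)) ⟦ a ⟧ ⟦ b ⟧ α ⟩
      ι (↧ a) * (ι (↧ b) * ⟦ b ⟧) * α + ι (↧ a) * ⟦ a ⟧ * ι (↧ b)
        ≈⟨ +-cong (*-congʳ (*-congˡ (clear b))) (*-congʳ (clear a)) ⟩
      ι (↧ a) * ι (↥ b) * α + ι (↥ a) * ι (↧ b)
        ≈⟨ +-cong (*-congʳ (ι-* (↧ a) (↥ b))) (ι-* (↥ a) (↧ b)) ⟨
      ι r * α + ι s ∎
    open PseudoDivision (+ t) r s
    rem≡0 = independent (rem₀ p) (rem₁ p) (eval-rem≈0 {+ t} {r} {s} root p root-p)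

  module _ (b₁ b₂ : Carrier)
    (independent : ∀ p q → ⟦ p ⟧ * b₁ + ⟦ q ⟧ * b₂ ≈ 0# → p ≡ 0ℚ × q ≡ 0ℚ) where

    infix 5 _∙_
    _∙_ : ℚ → ℚ → Carrier
    p ∙ q = ⟦ p ⟧ * b₁ + ⟦ q ⟧ * b₂

    ∙-cong : ∀ {p q p′ q′} → p ≡ p′ → q ≡ q′ → p ∙ q ≈ p′ ∙ q′
    ∙-cong ≡.refl ≡.refl = refl

    ∙-zero : 0ℚ ∙ 0ℚ ≈ 0#
    ∙-zero = trans (+-cong (trans (*-congʳ 0-homo) (zeroˡ b₁)) (trans (*-congʳ 0-homo) (zeroˡ b₂))) (+-identityʳ 0#)

    combine : ∀ x y p q p′ q′ → ⟦ x ⟧ * (p ∙ q) + ⟦ y ⟧ * (p′ ∙ q′) ≈ (x ℚ.* p ℚ.+ y ℚ.* p′) ∙ (x ℚ.* q ℚ.+ y ℚ.* q′)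
    combine x y p q p′ q′ = begin
      ⟦ x ⟧ * (p ∙ q) + ⟦ y ⟧ * (p′ ∙ q′)
        ≈⟨ solve 8 (λ x y p q p′ q′ b c → x :* (p :* b :+ q :* c) :+ y :* (p′ :* b :+ q′ :* c) := (x :* p :+ y :* p′) :* b :+ (x :* q :+ y :* q′) :* c) refl ⟦ x ⟧ ⟦ y ⟧ ⟦ p ⟧ ⟦ q ⟧ ⟦ p′ ⟧ ⟦ q′ ⟧ b₁ b₂ ⟩
      (⟦ x ⟧ * ⟦ p ⟧ + ⟦ y ⟧ * ⟦ p′ ⟧) * b₁ + (⟦ x ⟧ * ⟦ q ⟧ + ⟦ y ⟧ * ⟦ q′ ⟧) * b₂
        ≈⟨ +-cong (*-congʳ (homo p p′)) (*-congʳ (homo q q′)) ⟨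
      (x ℚ.* p ℚ.+ y ℚ.* p′) ∙ (x ℚ.* q ℚ.+ y ℚ.* q′) ∎
      where
      homo : ∀ p p′ → ⟦ x ℚ.* p ℚ.+ y ℚ.* p′ ⟧ ≈ ⟦ x ⟧ * ⟦ p ⟧ + ⟦ y ⟧ * ⟦ p′ ⟧
      homo p p′ = trans (+-homo (x ℚ.* p) (y ℚ.* p′)) (+-cong (*-homo x p) (*-homo y p′))

    -- If z maps to 0, then `z ∙ 0ℚ` is a relation between the basis elements. In particular 1
    -- differs from 0 in the ring.
    ⟦⟧-injective : ∀ z → ⟦ z ⟧ ≈ 0# → z ≡ 0ℚ
    ⟦⟧-injective z z≈0 = proj₁ (independent z 0ℚ (trans (+-congʳ (*-congʳ (trans z≈0 (sym 0-homo)))) ∙-zero))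

    module _ {α : Carrier} {p₀ q₀ p₁ q₁ p₂ q₂ : ℚ}
      (1≈ : 1# ≈ p₀ ∙ q₀) (α≈ : α ≈ p₁ ∙ q₁) (α²≈ : α * α ≈ p₂ ∙ q₂) where

      Δ : ℚ
      Δ = det p₀ p₁ q₀ q₁

      affine : ∀ x y → ⟦ x ⟧ + ⟦ y ⟧ * α ≈ (x ℚ.* p₀ ℚ.+ y ℚ.* p₁) ∙ (x ℚ.* q₀ ℚ.+ y ℚ.* q₁)
      affine x y = begin
        ⟦ x ⟧ + ⟦ y ⟧ * α                      ≈⟨ +-congʳ (*-identityʳ ⟦ x ⟧) ⟨
        ⟦ x ⟧ * 1# + ⟦ y ⟧ * α                 ≈⟨ +-cong (*-congˡ 1≈) (*-congˡ α≈) ⟩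
        ⟦ x ⟧ * (p₀ ∙ q₀) + ⟦ y ⟧ * (p₁ ∙ q₁)  ≈⟨ combine x y p₀ q₀ p₁ q₁ ⟩
        (x ℚ.* p₀ ℚ.+ y ℚ.* p₁) ∙ (x ℚ.* q₀ ℚ.+ y ℚ.* q₁) ∎

      open +-*-Solver using () renaming (solve to solveℚ; _:=_ to _:≡_; _:+_ to _⊕_; _:*_ to _⊗_; _:-_ to _⊖_; :-_ to ⊝_; con to conℚ)

      rational : ∀ c d → c ≢ 0ℚ → ((ℚ.- d) ℚ.* p₀ ℚ.+ c ℚ.* p₁ ≡ 0ℚ) → ((ℚ.- d) ℚ.* q₀ ℚ.+ c ℚ.* q₁ ≡ 0ℚ) → ∃[ z ] α ≈ ⟦ z ⟧
      rational c d c≢0 e₁ e₂ = 1/ c ℚ.* d , (begin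
        α                                    ≈⟨ *-identityˡ α ⟨
        1# * α                               ≈⟨ *-congʳ inverse ⟨
        c⁻¹ * ⟦ c ⟧ * α                      ≈⟨ solve 4 (λ i c d a → i :* c :* a := i :* d :+ i :* (:- d :+ c :* a)) refl c⁻¹ ⟦ c ⟧ ⟦ d ⟧ α ⟩
        c⁻¹ * ⟦ d ⟧ + c⁻¹ * (- ⟦ d ⟧ + ⟦ c ⟧ * α)  ≈⟨ +-congˡ (*-congˡ relation) ⟩
        c⁻¹ * ⟦ d ⟧ + c⁻¹ * 0#               ≈⟨ +-congˡ (zeroʳ c⁻¹) ⟩
        c⁻¹ * ⟦ d ⟧ + 0#                     ≈⟨ +-identityʳ _ ⟩
        c⁻¹ * ⟦ d ⟧                          ≈⟨ *-homo (1/ c) d ⟨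
        ⟦ 1/ c ℚ.* d ⟧                       ∎)
        where
        instance _ = ℚ.≢-nonZero c≢0
        c⁻¹ = ⟦ 1/ c ⟧
        inverse : c⁻¹ * ⟦ c ⟧ ≈ 1#
        inverse = trans (sym (*-homo (1/ c) c)) (trans (⟦⟧-cong (ℚₚ.*-inverseˡ c)) 1-homo)
        relation : - ⟦ d ⟧ + ⟦ c ⟧ * α ≈ 0#
        relation = trans (+-congʳ (sym (-‿homo d))) (trans (affine (ℚ.- d) c) (trans (∙-cong e₁ e₂) ∙-zero))

      -- The coordinates of α are proportional to those of 1, and the ratio is read off at a nonzero
      -- coordinate of 1. One exists, as otherwise 1 would be 0.
      Δ≡0⇒rational : Δ ≡ 0ℚ → ∃[ z ] α ≈ ⟦ z ⟧
      Δ≡0⇒rational Δ≡0 with p₀ ℚₚ.≟ 0ℚ | q₀ ℚₚ.≟ 0ℚ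
      ... | no  p₀≢0 | _ = rational p₀ p₁ p₀≢0
        (solveℚ 2 (λ a b → ⊝ b ⊗ a ⊕ a ⊗ b :≡ conℚ 0ℚ) ≡.refl p₀ p₁)
        (≡.trans (solveℚ 4 (λ a b c d → ⊝ b ⊗ c ⊕ a ⊗ d :≡ a ⊗ d ⊖ c ⊗ b) ≡.refl p₀ p₁ q₀ q₁) Δ≡0)
      ... | yes _ | no q₀≢0 = rational q₀ q₁ q₀≢0
        (≡.trans (solveℚ 4 (λ a b c d → ⊝ d ⊗ a ⊕ c ⊗ b :≡ ⊝ (a ⊗ d ⊖ c ⊗ b)) ≡.refl p₀ p₁ q₀ q₁) (≡.cong ℚ.-_ Δ≡0))
        (solveℚ 2 (λ a b → ⊝ b ⊗ a ⊕ a ⊗ b :≡ conℚ 0ℚ) ≡.refl q₀ q₁)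
      ... | yes p₀≡0 | yes q₀≡0 = contradiction
        (⟦⟧-injective 1ℚ (trans 1-homo (trans 1≈ (trans (∙-cong p₀≡0 q₀≡0) ∙-zero)))) λ ()

      module _ (Δ≢0 : Δ ≢ 0ℚ) where
        private instance _ = ℚ.≢-nonZero Δ≢0

        Δ≢0⇒independent : ∀ k m → ι k + ι m * α ≈ 0# → k ≡ 0ℤ × m ≡ 0ℤ
        Δ≢0⇒independent k m eq =
          let e₁ , e₂ = independent _ _ (trans (sym (affine (k / 1) (m / 1))) eq)
              k≡0 , m≡0 = det≢0⇒trivial p₀ p₁ q₀ q₁ Δ≢0 e₁ e₂
          in /1≡0 k k≡0 , /1≡0 m m≡0

        -- The coordinates of α² with respect to 1 and α.
        cramer₀ cramer₁ : ℚ
        cramer₀ = 1/ Δ ℚ.* (p₂ ℚ.* q₁ ℚ.- q₂ ℚ.* p₁)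
        cramer₁ = 1/ Δ ℚ.* (p₀ ℚ.* q₂ ℚ.- q₀ ℚ.* p₂)

        square : α * α ≈ ⟦ cramer₀ ⟧ + ⟦ cramer₁ ⟧ * α
        square = begin
          α * α      ≈⟨ α²≈ ⟩
          p₂ ∙ q₂    ≈⟨ ∙-cong (proj₁ solution) (proj₂ solution) ⟨
          (cramer₀ ℚ.* p₀ ℚ.+ cramer₁ ℚ.* p₁) ∙ (cramer₀ ℚ.* q₀ ℚ.+ cramer₁ ℚ.* q₁) ≈⟨ affine cramer₀ cramer₁ ⟨
          ⟦ cramer₀ ⟧ + ⟦ cramer₁ ⟧ * α ∎
          where solution = cramer p₀ p₁ q₀ q₁ p₂ q₂ (1/ Δ) (ℚₚ.*-inverseˡ Δ)

      quadraticInteger : ∀ p → Monic p → eval p α ≈ 0# → IsQuadraticInteger α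
      quadraticInteger p monic root-p with Δ ℚₚ.≟ 0ℚ
      ... | yes Δ≡0 = let z , α≈z = Δ≡0⇒rational Δ≡0 in rational⇒quadraticInteger ⟦⟧-injective α≈z p monic root-p
      ... | no  Δ≢0 = irrational⇒quadraticInteger (Δ≢0⇒independent Δ≢0) (cramer₀ Δ≢0) (cramer₁ Δ≢0) (square Δ≢0) p monic root-p

  -- Vanishing of the chromatic polynomial at α + t.

  open Polynomials using (_⊛[X-_]+_; falling⊛; edgeFactor; cliqueWithEdgePolynomial)

  eval-⊛ : ∀ p k c x → eval (p ⊛[X- k ]+ c) x ≈ (x - ι k) * eval p x + ι c
  eval-⊛ []      k c x = begin
    ι c + x * 0#               ≈⟨ +-congˡ (zeroʳ x) ⟩
    ι c + 0#                   ≈⟨ +-comm (ι c) 0# ⟩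
    0# + ι c                   ≈⟨ +-congʳ (zeroʳ (x - ι k)) ⟨
    (x - ι k) * 0# + ι c       ∎
  eval-⊛ (a ∷ p) k c x = begin
    ι (c ℤ.- k ℤ.* a) + x * eval (p ⊛[X- k ]+ a) x
      ≈⟨ +-cong (trans (ι-- c (k ℤ.* a)) (+-congˡ (-‿cong (ι-* k a)))) (*-congˡ (eval-⊛ p k a x)) ⟩
    ι c - ι k * ι a + x * ((x - ι k) * eval p x + ι a)
      ≈⟨ solve 5 (λ a k c x v → c :- k :* a :+ x :* ((x :- k) :* v :+ a) := (x :- k) :* (a :+ x :* v) :+ c) refl (ι a) (ι k) (ι c) x (eval p x) ⟩
    (x - ι k) * (ι a + x * eval p x) + ι c ∎

  eval-falling⊛≈0 : ∀ a p {x} → eval p x ≈ 0# → eval (falling⊛ a p) x ≈ 0#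
  eval-falling⊛≈0 zero    p     h = h
  eval-falling⊛≈0 (suc a) p {x} h = begin
    eval (falling⊛ a p ⊛[X- + a ]+ 0ℤ) x              ≈⟨ eval-⊛ (falling⊛ a p) (+ a) 0ℤ x ⟩
    (x - ι (+ a)) * eval (falling⊛ a p) x + ι 0ℤ      ≈⟨ +-cong (*-congˡ (eval-falling⊛≈0 a p h)) 0-homo ⟩
    (x - ι (+ a)) * 0# + 0#                           ≈⟨ trans (+-identityʳ _) (zeroʳ _) ⟩
    0#                                                ∎

  eval-edgeFactor : ∀ n m u x → eval (edgeFactor n m u) x ≈ (x - ι n) * (x - ι m) - (x - ι u)
  eval-edgeFactor n m u x = begin
    ι (n ℤ.* m ℤ.+ u) + x * (ι (ℤ.- (n ℤ.+ m ℤ.+ 1ℤ)) + x * (ι 1ℤ + x * 0#))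
      ≈⟨ +-cong (trans (ι-+ (n ℤ.* m) u) (+-congʳ (ι-* n m))) (*-congˡ (+-cong
           (trans (ι-neg (n ℤ.+ m ℤ.+ 1ℤ)) (-‿cong (trans (ι-+ (n ℤ.+ m) 1ℤ) (+-congʳ (ι-+ n m)))))
           (*-congˡ (trans (+-congˡ (zeroʳ x)) (+-identityʳ (ι 1ℤ)))))) ⟩
    ι n * ι m + ι u + x * (- (ι n + ι m + ι 1ℤ) + x * ι 1ℤ)
      -- `con 1ℚ` stands for `ι 1ℤ`, since `1ℤ / 1` computes to `1ℚ`.
      ≈⟨ solve 4 (λ n m u x → n :* m :+ u :+ x :* (:- (n :+ m :+ con 1ℚ) :+ x :* con 1ℚ) := (x :- n) :* (x :- m) :- (x :- u)) refl (ι n) (ι m) (ι u) x ⟩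
    (x - ι n) * (x - ι m) - (x - ι u) ∎

  eval-cliqueWithEdgePolynomial≈0 : ∀ {u v α} w s t →
    + s ≡ + w ℤ.* + w ℤ.- u ℤ.* + w ℤ.- v → + t ≡ + s ℤ.+ (+ w ℤ.+ + w ℤ.+ 1ℤ ℤ.- u) →
    α * α ≈ ι u * α + ι v → eval (cliqueWithEdgePolynomial w s t) (α + ι (+ t)) ≈ 0#
  eval-cliqueWithEdgePolynomial≈0 {u} {v} {α} w s t s≡ t≡ root =
    eval-falling⊛≈0 (w ℕ.+ (s ℕ.+ t)) (edgeFactor (+ (w ℕ.+ t)) (+ (w ℕ.+ s)) (+ (w ℕ.+ (s ℕ.+ t)))) (begin
      eval (edgeFactor (+ (w ℕ.+ t)) (+ (w ℕ.+ s)) (+ (w ℕ.+ (s ℕ.+ t)))) (α + T)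
        ≈⟨ eval-edgeFactor (+ (w ℕ.+ t)) (+ (w ℕ.+ s)) (+ (w ℕ.+ (s ℕ.+ t))) (α + T) ⟩
      (α + T - ι (+ (w ℕ.+ t))) * (α + T - ι (+ (w ℕ.+ s))) - (α + T - ι (+ (w ℕ.+ (s ℕ.+ t))))
        ≈⟨ +-cong (*-cong (+-congˡ (-‿cong (ι-+ (+ w) (+ t)))) (+-congˡ (-‿cong (ι-+ (+ w) (+ s)))))
             (-‿cong (+-congˡ (-‿cong (trans (ι-+ (+ w) (+ (s ℕ.+ t))) (+-congˡ (ι-+ (+ s) (+ t))))))) ⟩
      (α + T - (W + T)) * (α + T - (W + S)) - (α + T - (W + (S + T)))
        ≈⟨ solve 4 (λ a w s t → (a :+ t :- (w :+ t)) :* (a :+ t :- (w :+ s)) :- (a :+ t :- (w :+ (s :+ t))) := (a :- w) :* (a :+ t :- w :- s) :- (a :- w) :+ s) refl α W S T ⟩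
      (α - W) * (α + T - W - S) - (α - W) + S
        ≈⟨ +-congʳ (+-congʳ (*-congˡ (+-congʳ (+-congʳ (+-congˡ T≈))))) ⟩
      (α - W) * (α + (S + (W + W + ι 1ℤ - U)) - W - S) - (α - W) + S
        -- Only the isolated S is replaced; inside the product, S already cancels against the S
        -- contained in T.
        ≈⟨ +-congˡ S≈ ⟩
      (α - W) * (α + (S + (W + W + ι 1ℤ - U)) - W - S) - (α - W) + (W * W - U * W - V)
        ≈⟨ solve 5 (λ a w s u v → (a :- w) :* (a :+ (s :+ (w :+ w :+ con 1ℚ :- u)) :- w :- s) :- (a :- w) :+ (w :* w :- u :* w :- v) := a :* a :- (u :* a :+ v)) refl α W S U V ⟩
      α * α - (U * α + V)
        ≈⟨ +-congʳ root ⟩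
      U * α + V - (U * α + V)
        ≈⟨ -‿inverseʳ _ ⟩
      0# ∎)
    where
    W = ι (+ w)
    S = ι (+ s)
    T = ι (+ t)
    U = ι u
    V = ι v
    S≈ : S ≈ W * W - U * W - V
    S≈ = trans (ι-cong s≡) (trans (ι-- (+ w ℤ.* + w ℤ.- u ℤ.* + w) v) (+-congʳ
      (trans (ι-- (+ w ℤ.* + w) (u ℤ.* + w)) (+-cong (ι-* (+ w) (+ w)) (-‿cong (ι-* u (+ w)))))))
    T≈ : T ≈ S + (W + W + ι 1ℤ - U)
    T≈ = trans (ι-cong t≡) (trans (ι-+ (+ s) (+ w ℤ.+ + w ℤ.+ 1ℤ ℤ.- u)) (+-congˡ
      (trans (ι-- (+ w ℤ.+ + w ℤ.+ 1ℤ) u) (+-congʳ (trans (ι-+ (+ w ℤ.+ + w) 1ℤ) (+-congʳ (ι-+ (+ w) (+ w))))))))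

open import Data.Nat using (_⊔_)
import Data.Nat.Properties as ℕₚ
open import Data.Product using (∃-syntax; _,_)
open import Data.Rational using (0ℚ; 1ℚ; ½; ∣_∣; 1/_; _≤_) renaming (_+_ to _+ᵠ_; _*_ to _*ᵠ_; -_ to -ᵠ_; _-_ to _-ᵠ_)
import Data.Rational.Properties as ℚₚ
open import Data.Rational.Solver using (module +-*-Solver)
open import Relation.Binary.PropositionalEquality using (_≡_; refl; sym; trans; cong; cong₂; subst)
open import Relation.Unary using (Pred; _∈_)
open import Defs

-- The commutative ring of complex numbers and the embedding of the rationals.

≈ᴿ-pointwise : ∀ {x y} → (∀ n → seq x n ≡ seq y n) → x ≈ᴿ y
≈ᴿ-pointwise {x} {y} eq ε = 0 , λ n _ →
  subst (λ z → ∣ z ∣ ≤ ε)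
    (sym (trans (cong (_-ᵠ seq y n) (eq n)) (ℚₚ.+-inverseʳ (seq y n))))
    (ℚₚ.nonNegative⁻¹ ε {{ℚₚ.pos⇒nonNeg ε}})

≈ᴿ-refl : ∀ {x} → x ≈ᴿ x
≈ᴿ-refl {x} = ≈ᴿ-pointwise {x} {x} λ _ → refl

-ᴿ-cong : ∀ {x y} → x ≈ᴿ y → -ᴿ x ≈ᴿ -ᴿ y
-ᴿ-cong {x} {y} x≈y ε = let N , h = x≈y ε in N , λ n N≤n →
  subst (_≤ ε)
    (trans (sym (ℚₚ.∣-p∣≡∣p∣ (seq x n -ᵠ seq y n)))
           (cong ∣_∣ (ℚₚ.neg-distrib-+ (seq x n) (-ᵠ seq y n))))
    (h n N≤n)

≈ᴿ-sym : ∀ {x y} → x ≈ᴿ y → y ≈ᴿ x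
≈ᴿ-sym {x} {y} x≈y ε = let N , h = x≈y ε in N , λ n N≤n →
  subst (_≤ ε)
    (trans (sym (ℚₚ.∣-p∣≡∣p∣ (seq x n -ᵠ seq y n)))
           (cong ∣_∣ (solve 2 (λ a b → :- (a :- b) := b :- a) refl (seq x n) (seq y n))))
    (h n N≤n)
  where open +-*-Solver

private
  half+half : ∀ ε → ε *ᵠ ½ +ᵠ ε *ᵠ ½ ≡ ε
  half+half ε = trans (sym (ℚₚ.*-distribˡ-+ ε ½ ½)) (ℚₚ.*-identityʳ ε)

≈ᴿ-trans : ∀ {x y z} → x ≈ᴿ y → y ≈ᴿ z → x ≈ᴿ z
≈ᴿ-trans {x} {y} {z} x≈y y≈z ε =
  let instance _ = ℚₚ.pos*pos⇒pos ε ½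
      N₁ , h₁ = x≈y (ε *ᵠ ½)
      N₂ , h₂ = y≈z (ε *ᵠ ½)
  in N₁ ⊔ N₂ , λ n p → let open ℚₚ.≤-Reasoning in begin
    ∣ seq x n -ᵠ seq z n ∣
      ≡⟨ cong ∣_∣ (solve 3 (λ a b c → a :- c := (a :- b) :+ (b :- c)) refl (seq x n) (seq y n) (seq z n)) ⟩
    ∣ (seq x n -ᵠ seq y n) +ᵠ (seq y n -ᵠ seq z n) ∣
      ≤⟨ ℚₚ.∣p+q∣≤∣p∣+∣q∣ (seq x n -ᵠ seq y n) (seq y n -ᵠ seq z n) ⟩
    ∣ seq x n -ᵠ seq y n ∣ +ᵠ ∣ seq y n -ᵠ seq z n ∣
      ≤⟨ ℚₚ.+-mono-≤ (h₁ n (ℕₚ.m⊔n≤o⇒m≤o N₁ N₂ p)) (h₂ n (ℕₚ.m⊔n≤o⇒n≤o N₁ N₂ p)) ⟩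
    ε *ᵠ ½ +ᵠ ε *ᵠ ½
      ≡⟨ half+half ε ⟩
    ε ∎
  where open +-*-Solver

+ᴿ-cong : ∀ {x x′ y y′} → x ≈ᴿ x′ → y ≈ᴿ y′ → x +ᴿ y ≈ᴿ x′ +ᴿ y′
+ᴿ-cong {x} {x′} {y} {y′} x≈x′ y≈y′ ε =
  let instance _ = ℚₚ.pos*pos⇒pos ε ½
      N₁ , h₁ = x≈x′ (ε *ᵠ ½)
      N₂ , h₂ = y≈y′ (ε *ᵠ ½)
  in N₁ ⊔ N₂ , λ n p → let open ℚₚ.≤-Reasoning in begin
    ∣ (seq x n +ᵠ seq y n) -ᵠ (seq x′ n +ᵠ seq y′ n) ∣
      ≡⟨ cong ∣_∣ (solve 4 (λ a b c d → (a :+ b) :- (c :+ d) := (a :- c) :+ (b :- d)) refl (seq x n) (seq y n) (seq x′ n) (seq y′ n)) ⟩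
    ∣ (seq x n -ᵠ seq x′ n) +ᵠ (seq y n -ᵠ seq y′ n) ∣
      ≤⟨ ℚₚ.∣p+q∣≤∣p∣+∣q∣ (seq x n -ᵠ seq x′ n) (seq y n -ᵠ seq y′ n) ⟩
    ∣ seq x n -ᵠ seq x′ n ∣ +ᵠ ∣ seq y n -ᵠ seq y′ n ∣
      ≤⟨ ℚₚ.+-mono-≤ (h₁ n (ℕₚ.m⊔n≤o⇒m≤o N₁ N₂ p)) (h₂ n (ℕₚ.m⊔n≤o⇒n≤o N₁ N₂ p)) ⟩
    ε *ᵠ ½ +ᵠ ε *ᵠ ½
      ≡⟨ half+half ε ⟩
    ε ∎
  where open +-*-Solver

*ᴿ-comm : ∀ x y → x *ᴿ y ≈ᴿ y *ᴿ x
*ᴿ-comm x y = ≈ᴿ-pointwise {x *ᴿ y} {y *ᴿ x} λ n → ℚₚ.*-comm (seq x n) (seq y n)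

-- The Cauchy sequence z is eventually bounded by some B > 0, so tolerance ε / B between x and y is
-- enough.
*ᴿ-congˡ : ∀ z {x y} → x ≈ᴿ y → z *ᴿ x ≈ᴿ z *ᴿ y
*ᴿ-congˡ z {x} {y} x≈y ε =
  let B , B>0 , M , b = cauchy-bounded {seq z} (cauchy z)
      instance
        _ = B>0
        _ = ℚₚ.pos⇒nonNeg B
        _ = ℚₚ.pos⇒nonZero B
        _ = ℚₚ.1/pos⇒pos B
        _ = ℚₚ.pos*pos⇒pos ε (1/ B)
      N , h = x≈y (ε *ᵠ 1/ B)
  in M ⊔ N , λ n p → let open ℚₚ.≤-Reasoning in begin
    ∣ seq z n *ᵠ seq x n -ᵠ seq z n *ᵠ seq y n ∣
      ≡⟨ cong ∣_∣ (solve 3 (λ c a b → c :* a :- c :* b := c :* (a :- b)) refl (seq z n) (seq x n) (seq y n)) ⟩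
    ∣ seq z n *ᵠ (seq x n -ᵠ seq y n) ∣
      ≤⟨ ∣*∣-mono-≤ {seq z n} {seq x n -ᵠ seq y n} (b n (ℕₚ.m⊔n≤o⇒m≤o M N p)) (h n (ℕₚ.m⊔n≤o⇒n≤o M N p)) ⟩
    B *ᵠ (ε *ᵠ 1/ B)
      ≡⟨ solve 3 (λ c e i → c :* (e :* i) := e :* (c :* i)) refl B ε (1/ B) ⟩
    ε *ᵠ (B *ᵠ 1/ B)
      ≡⟨ trans (cong (ε *ᵠ_) (ℚₚ.*-inverseʳ B)) (ℚₚ.*-identityʳ ε) ⟩
    ε ∎
  where open +-*-Solver

*ᴿ-cong : ∀ {x x′ y y′} → x ≈ᴿ x′ → y ≈ᴿ y′ → x *ᴿ y ≈ᴿ x′ *ᴿ y′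
*ᴿ-cong {x} {x′} {y} {y′} x≈x′ y≈y′ =
  ≈ᴿ-trans {x *ᴿ y} {x *ᴿ y′} {x′ *ᴿ y′} (*ᴿ-congˡ x {y} {y′} y≈y′)
  (≈ᴿ-trans {x *ᴿ y′} {y′ *ᴿ x} {x′ *ᴿ y′} (*ᴿ-comm x y′)
  (≈ᴿ-trans {y′ *ᴿ x} {y′ *ᴿ x′} {x′ *ᴿ y′} (*ᴿ-congˡ y′ {x} {x′} x≈x′) (*ᴿ-comm y′ x′)))

-- Operations act termwise, so every ring law holds exactly at each index and becomes an identity in
-- `ℚ`. Estimates are left to the equivalence and congruence properties.
≈-pointwise : ∀ {z w} → (∀ n → seq (re z) n ≡ seq (re w) n) → (∀ n → seq (im z) n ≡ seq (im w) n) → z ≈ w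
≈-pointwise {z} {w} p q = ≈ᴿ-pointwise {re z} {re w} p , ≈ᴿ-pointwise {im z} {im w} q

*-cong : ∀ {z z′ w w′} → z ≈ z′ → w ≈ w′ → z * w ≈ z′ * w′
*-cong {a +i b} {a′ +i b′} {c +i d} {c′ +i d′} (a≈ , b≈) (c≈ , d≈) =
    +ᴿ-cong {a *ᴿ c} {a′ *ᴿ c′} { -ᴿ (b *ᴿ d)} { -ᴿ (b′ *ᴿ d′)}
      (*ᴿ-cong {a} {a′} {c} {c′} a≈ c≈)
      (-ᴿ-cong {b *ᴿ d} {b′ *ᴿ d′} (*ᴿ-cong {b} {b′} {d} {d′} b≈ d≈))
  , +ᴿ-cong {a *ᴿ d} {a′ *ᴿ d′} {b *ᴿ c} {b′ *ᴿ c′}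
      (*ᴿ-cong {a} {a′} {d} {d′} a≈ d≈) (*ᴿ-cong {b} {b′} {c} {c′} b≈ c≈)

*-assoc : ∀ x y z → (x * y) * z ≈ x * (y * z)
*-assoc x y z = ≈-pointwise {(x * y) * z} {x * (y * z)}
  (λ n → solve 6 (λ a b c d e f →
     (a :* c :+ :- (b :* d)) :* e :+ :- ((a :* d :+ b :* c) :* f) :=
     a :* (c :* e :+ :- (d :* f)) :+ :- (b :* (c :* f :+ d :* e))) refl
     (seq (re x) n) (seq (im x) n) (seq (re y) n) (seq (im y) n) (seq (re z) n) (seq (im z) n))
  (λ n → solve 6 (λ a b c d e f →
     (a :* c :+ :- (b :* d)) :* f :+ (a :* d :+ b :* c) :* e :=
     a :* (c :* f :+ d :* e) :+ b :* (c :* e :+ :- (d :* f))) refl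
     (seq (re x) n) (seq (im x) n) (seq (re y) n) (seq (im y) n) (seq (re z) n) (seq (im z) n))
  where open +-*-Solver

*-comm : ∀ x y → x * y ≈ y * x
*-comm x y = ≈-pointwise {x * y} {y * x}
  (λ n → solve 4 (λ a b c d → a :* c :+ :- (b :* d) := c :* a :+ :- (d :* b)) refl
     (seq (re x) n) (seq (im x) n) (seq (re y) n) (seq (im y) n))
  (λ n → solve 4 (λ a b c d → a :* d :+ b :* c := c :* b :+ d :* a) refl
     (seq (re x) n) (seq (im x) n) (seq (re y) n) (seq (im y) n))
  where open +-*-Solver

*-identityˡ : ∀ x → 1ℂ * x ≈ x
*-identityˡ x = ≈-pointwise {1ℂ * x} {x}
  (λ n → solve 2 (λ a b → con 1ℚ :* a :+ :- (con 0ℚ :* b) := a) refl (seq (re x) n) (seq (im x) n))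
  (λ n → solve 2 (λ a b → con 1ℚ :* b :+ con 0ℚ :* a := b) refl (seq (re x) n) (seq (im x) n))
  where open +-*-Solver

*-distribˡ-+ : ∀ x y z → x * (y + z) ≈ x * y + x * z
*-distribˡ-+ x y z = ≈-pointwise {x * (y + z)} {x * y + x * z}
  (λ n → solve 6 (λ a b c d e f →
     a :* (c :+ e) :+ :- (b :* (d :+ f)) :=
     (a :* c :+ :- (b :* d)) :+ (a :* e :+ :- (b :* f))) refl
     (seq (re x) n) (seq (im x) n) (seq (re y) n) (seq (im y) n) (seq (re z) n) (seq (im z) n))
  (λ n → solve 6 (λ a b c d e f →
     a :* (d :+ f) :+ b :* (c :+ e) :=
     (a :* d :+ b :* c) :+ (a :* f :+ b :* e)) refl
     (seq (re x) n) (seq (im x) n) (seq (re y) n) (seq (im y) n) (seq (re z) n) (seq (im z) n))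
  where open +-*-Solver

ℂ-commutativeRing : CommutativeRing 0ℓ 0ℓ
ℂ-commutativeRing = record
  { Carrier = ℂ ; _≈_ = _≈_ ; _+_ = _+_ ; _*_ = _*_ ; -_ = -_ ; 0# = 0ℂ ; 1# = 1ℂ
  ; isCommutativeRing = record
    { isRing = record
      { +-isAbelianGroup = record
        { isGroup = record
          { isMonoid = record
            { isSemigroup = record
              { isMagma = record
                { isEquivalence = record
                  { refl = λ {x} → ≈ᴿ-refl {re x} , ≈ᴿ-refl {im x}
                  ; sym = λ {x} {y} (p , q) → ≈ᴿ-sym {re x} {re y} p , ≈ᴿ-sym {im x} {im y} q
                  ; trans = λ {x} {y} {z} → ≈-trans {x} {y} {z} }
                ; ∙-cong = λ {x} {y} {u} {v} (p , q) (p′ , q′) →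
                    +ᴿ-cong {re x} {re y} {re u} {re v} p p′ , +ᴿ-cong {im x} {im y} {im u} {im v} q q′ }
              ; assoc = λ x y z → ≈-pointwise {x + y + z} {x + (y + z)}
                  (λ n → ℚₚ.+-assoc (seq (re x) n) (seq (re y) n) (seq (re z) n))
                  (λ n → ℚₚ.+-assoc (seq (im x) n) (seq (im y) n) (seq (im z) n)) }
            ; identity =
                (λ x → ≈-pointwise {0ℂ + x} {x} (λ n → ℚₚ.+-identityˡ (seq (re x) n)) (λ n → ℚₚ.+-identityˡ (seq (im x) n)))
              , (λ x → ≈-pointwise {x + 0ℂ} {x} (λ n → ℚₚ.+-identityʳ (seq (re x) n)) (λ n → ℚₚ.+-identityʳ (seq (im x) n))) }
          ; inverse =
              (λ x → ≈-pointwise { - x + x} {0ℂ} (λ n → ℚₚ.+-inverseˡ (seq (re x) n)) (λ n → ℚₚ.+-inverseˡ (seq (im x) n)))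
            , (λ x → ≈-pointwise {x + - x} {0ℂ} (λ n → ℚₚ.+-inverseʳ (seq (re x) n)) (λ n → ℚₚ.+-inverseʳ (seq (im x) n)))
          ; ⁻¹-cong = λ {x} {y} (p , q) → -ᴿ-cong {re x} {re y} p , -ᴿ-cong {im x} {im y} q }
        ; comm = λ x y → ≈-pointwise {x + y} {y + x}
            (λ n → ℚₚ.+-comm (seq (re x) n) (seq (re y) n)) (λ n → ℚₚ.+-comm (seq (im x) n) (seq (im y) n)) }
      ; *-cong = λ {x} {y} {u} {v} → *-cong {x} {y} {u} {v}
      ; *-assoc = *-assoc
      ; *-identity = *-identityˡ , λ x → ≈-trans {x * 1ℂ} {1ℂ * x} {x} (*-comm x 1ℂ) (*-identityˡ x)
      ; distrib = *-distribˡ-+ , λ x y z →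
          ≈-trans {(y + z) * x} {x * (y + z)} {y * x + z * x} (*-comm (y + z) x)
          (≈-trans {x * (y + z)} {x * y + x * z} {y * x + z * x} (*-distribˡ-+ x y z)
          (+-cong {x * y} {y * x} {x * z} {z * x} (*-comm x y) (*-comm x z))) }
    ; *-comm = *-comm } }
  where
    ≈-trans : ∀ {x y z} → x ≈ y → y ≈ z → x ≈ z
    ≈-trans {x} {y} {z} (p , q) (p′ , q′) = ≈ᴿ-trans {re x} {re y} {re z} p p′ , ≈ᴿ-trans {im x} {im y} {im z} q q′
    +-cong : ∀ {x y u v} → x ≈ y → u ≈ v → x + u ≈ y + v
    +-cong {x} {y} {u} {v} (p , q) (p′ , q′) =
      +ᴿ-cong {re x} {re y} {re u} {re v} p p′ , +ᴿ-cong {im x} {im y} {im u} {im v} q q′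

fromℚ-homomorphism : Data.Rational.+-*-rawRing -Raw-AlmostCommutative⟶ fromCommutativeRing ℂ-commutativeRing
fromℚ-homomorphism = record
  { ⟦_⟧    = fromℚ
  ; +-homo = λ p q → ≈-pointwise {fromℚ (p +ᵠ q)} {fromℚ p + fromℚ q} (λ _ → refl) (λ _ → refl)
  -- The real part of the product is p q - 0 · 0, the imaginary part p · 0 + 0 · q.
  ; *-homo = λ p q → ≈-pointwise {fromℚ (p *ᵠ q)} {fromℚ p * fromℚ q}
      (λ _ → sym (ℚₚ.+-identityʳ (p *ᵠ q))) (λ _ → sym (cong₂ _+ᵠ_ (ℚₚ.*-zeroʳ p) (ℚₚ.*-zeroˡ q)))
  ; -‿homo = λ p → ≈-pointwise {fromℚ (-ᵠ p)} { - fromℚ p} (λ _ → refl) (λ _ → refl)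
  ; 0-homo = ≈-pointwise {0ℂ} {0ℂ} (λ _ → refl) (λ _ → refl)
  ; 1-homo = ≈-pointwise {1ℂ} {1ℂ} (λ _ → refl) (λ _ → refl)
  }

theorem4 : ∀ {ℓ} (K : Pred ℂ ℓ) → IsQuadraticField K → (α : ℂ) → α ∈ K → IsAlgebraicInteger α → ∃[ n ] IsChromaticRoot (α + fromℕ n)
theorem4 K K-quadratic α α∈K (p , monic , root-p) =
  let p₀ , q₀ , 1≈  = spanning 1∈K
      p₁ , q₁ , α≈  = spanning α∈K
      p₂ , q₂ , α²≈ = spanning (*∈K α∈K α∈K)
      u , v , root = quadraticInteger b₁ b₂ independent {α} {p₀} {q₀} {p₁} {q₁} {p₂} {q₂} 1≈ α≈ α²≈ p monic root-p
      w , s , t , s≡ , t≡ = parameters u v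
      G , isChromatic-G = isChromatic w s t
  in t , G , cliqueWithEdgePolynomial w s t , isChromatic-G , eval-cliqueWithEdgePolynomial≈0 {u} {v} {α} w s t s≡ t≡ root
  where
  open IsQuadraticField K-quadratic
  open IsSubfield isSubfield
  open Polynomials using (parameters; isChromatic; cliqueWithEdgePolynomial)
  open RationalAlgebra ℂ-commutativeRing fromℚ-homomorphism
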